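{- Let $n\ge 4$ and let $\mathcal{G}=\{G_1,G_2,\ldots,G_n\}$ be a family of graphs on the same vertex set $[n]$ such that $\rho(G_i)>n-2$ for every $i=1,\ldots,n$. Then $\mathcal{G}$ admits a rainbow Hamiltonian cycle, unless $G_1=G_2=\cdots=G_n\cong K_1\vee(K_{n-2}\cup K_1)$.
   Context: $\rho(G)$ is the spectral radius (largest eigenvalue) of the adjacency matrix of $G$. $\vee$ denotes the join and $\cup$ the disjoint union of graphs; $K_1\vee(K_{n-2}\cup K_1)$ is the graph consisting of $K_{n-1}$ plus one extra vertex of degree 1 adjacent to a vertex of the $K_{n-1}$. $G_i=G_j$ means equal vertex and edge sets (not merely isomorphic). A rainbow Hamiltonian cycle in $\mathcal{G}$ is a Hamiltonian cycle on the common vertex set whose $n$ edges can be labeled $e_1,\ldots,e_n$ with $e_i\in E(G_i)$ for each $i$. -}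

module Defs where

open import Algebra.Bundles.Raw using (RawMonoid)
import Algebra.Definitions.RawMonoid as RawMonoidDefinitions
open import Data.Bool.Base using (Bool; true; false; not; if_then_else_)
open import Data.Fin.Base using (Fin; toℕ)
open import Data.Fin.Permutation using (Permutation′; _⟨$⟩ʳ_)
import Data.Fin.Properties as Fin
open import Data.Integer.Base using (+_)
open import Data.Nat.Base as ℕ using (ℕ; suc; _⊔_)
open import Data.Nat.DivMod using (_mod_)
import Data.Nat.Properties as ℕ
open import Data.Product.Base using (Σ-syntax; ∃-syntax; _×_; _,_)
open import Data.Rational.Base as ℚ using (ℚ; 0ℚ; 1ℚ; ½; ∣_∣)
open import Data.Rational.Literals using (fromℤ)
import Data.Rational.Properties as ℚ
open import Data.Rational.Solver using (module +-*-Solver)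
open import Data.Sum.Base using (_⊎_; inj₁; inj₂)
open import Function.Bundles using (_↔_; Inverse)
open import Level using (0ℓ)
open import Relation.Binary.PropositionalEquality as ≡
  using (_≡_; refl; cong; subst; trans)
open import Relation.Nullary using (¬_; does; yes; no; contradiction)
open import Relation.Nullary.Decidable using (dec-true)

------------------------------------------------------------------------
-- Real numbers, as Cauchy sequences of rationals modulo null sequences

IsCauchy : (ℕ → ℚ) → Set
IsCauchy x = ∀ ε → 0ℚ ℚ.< ε →
  ∃[ N ] (∀ m n → N ℕ.≤ m → N ℕ.≤ n → ∣ x m ℚ.- x n ∣ ℚ.≤ ε)

record ℝ : Set where
  constructor mkℝ
  field
    seq    : ℕ → ℚ
    cauchy : IsCauchy seq

open ℝ public

infix  4 _≈ᴿ_ _<ᴿ_ _≤ᴿ_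
infixl 6 _+ᴿ_
infixl 7 _*ᴿ_

_≈ᴿ_ : ℝ → ℝ → Set
x ≈ᴿ y = ∀ ε → 0ℚ ℚ.< ε →
  ∃[ N ] (∀ n → N ℕ.≤ n → ∣ seq x n ℚ.- seq y n ∣ ℚ.≤ ε)

_<ᴿ_ : ℝ → ℝ → Set
x <ᴿ y = ∃[ ε ] (0ℚ ℚ.< ε ×
  (∃[ N ] (∀ n → N ℕ.≤ n → seq x n ℚ.+ ε ℚ.≤ seq y n)))

_≤ᴿ_ : ℝ → ℝ → Set
x ≤ᴿ y = ¬ (y <ᴿ x)

private
  open +-*-Solver using (solve; _:=_; _:+_; _:*_; _:-_; con)

  half-pos : ∀ {ε} → 0ℚ ℚ.< ε → 0ℚ ℚ.< ½ ℚ.* ε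
  half-pos 0<ε = ℚ.*-monoʳ-<-pos ½ 0<ε

  half+half : ∀ ε → ½ ℚ.* ε ℚ.+ ½ ℚ.* ε ≡ ε
  half+half ε = trans (≡.sym (ℚ.*-distribʳ-+ ε ½ ½)) (ℚ.*-identityˡ ε)

  +-cauchy : ∀ x y → IsCauchy x → IsCauchy y → IsCauchy (λ n → x n ℚ.+ y n)
  +-cauchy x y cx cy ε 0<ε
    with M , p ← cx (½ ℚ.* ε) (half-pos 0<ε)
       | N , q ← cy (½ ℚ.* ε) (half-pos 0<ε)
    = M ⊔ N , λ m n m≥ n≥ → begin
      ∣ (x m ℚ.+ y m) ℚ.- (x n ℚ.+ y n) ∣
        ≡⟨ cong ∣_∣ (rearrange (x m) (y m) (x n) (y n)) ⟩
      ∣ (x m ℚ.- x n) ℚ.+ (y m ℚ.- y n) ∣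
        ≤⟨ ℚ.∣p+q∣≤∣p∣+∣q∣ (x m ℚ.- x n) (y m ℚ.- y n) ⟩
      ∣ x m ℚ.- x n ∣ ℚ.+ ∣ y m ℚ.- y n ∣
        ≤⟨ ℚ.+-mono-≤
             (p m n (ℕ.m⊔n≤o⇒m≤o M N m≥) (ℕ.m⊔n≤o⇒m≤o M N n≥))
             (q m n (ℕ.m⊔n≤o⇒n≤o M N m≥) (ℕ.m⊔n≤o⇒n≤o M N n≥)) ⟩
      ½ ℚ.* ε ℚ.+ ½ ℚ.* ε
        ≡⟨ half+half ε ⟩
      ε ∎
    where
    open ℚ.≤-Reasoning
    rearrange : ∀ a b c d → (a ℚ.+ b) ℚ.- (c ℚ.+ d) ≡ (a ℚ.- c) ℚ.+ (b ℚ.- d)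
    rearrange = solve 4 (λ a b c d →
      ((a :+ b) :- (c :+ d)) := ((a :- c) :+ (b :- d))) refl

  eventuallyBounded : ∀ x → IsCauchy x →
    ∃[ B ] (0ℚ ℚ.< B × ∃[ N ] (∀ n → N ℕ.≤ n → ∣ x n ∣ ℚ.≤ B))
  eventuallyBounded x cx
    with N , p ← cx 1ℚ (ℚ.positive⁻¹ 1ℚ)
    = 1ℚ ℚ.+ ∣ x N ∣
    , ℚ.+-mono-<-≤ (ℚ.positive⁻¹ 1ℚ) (ℚ.0≤∣p∣ (x N))
    , N , λ n n≥ → begin
      ∣ x n ∣
        ≡⟨ cong ∣_∣ (split (x n) (x N)) ⟩
      ∣ (x n ℚ.- x N) ℚ.+ x N ∣
        ≤⟨ ℚ.∣p+q∣≤∣p∣+∣q∣ (x n ℚ.- x N) (x N) ⟩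
      ∣ x n ℚ.- x N ∣ ℚ.+ ∣ x N ∣
        ≤⟨ ℚ.+-monoˡ-≤ ∣ x N ∣ (p n N n≥ ℕ.≤-refl) ⟩
      1ℚ ℚ.+ ∣ x N ∣ ∎
    where
    open ℚ.≤-Reasoning
    split : ∀ a b → a ≡ (a ℚ.- b) ℚ.+ b
    split = solve 2 (λ a b → a := ((a :- b) :+ b)) refl

  ∣*∣-mono : ∀ {b d} a c → 0ℚ ℚ.< b → ∣ a ∣ ℚ.≤ b → ∣ c ∣ ℚ.≤ d → ∣ a ℚ.* c ∣ ℚ.≤ b ℚ.* d
  ∣*∣-mono {b} {d} a c 0<b a≤b c≤d = begin
    ∣ a ℚ.* c ∣      ≡⟨ ℚ.∣p*q∣≡∣p∣*∣q∣ a c ⟩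
    ∣ a ∣ ℚ.* ∣ c ∣  ≤⟨ ℚ.*-monoʳ-≤-nonNeg ∣ c ∣ {{ℚ.nonNegative (ℚ.0≤∣p∣ c)}} a≤b ⟩
    b ℚ.* ∣ c ∣      ≤⟨ ℚ.*-monoˡ-≤-nonNeg b {{ℚ.nonNegative (ℚ.<⇒≤ 0<b)}} c≤d ⟩
    b ℚ.* d          ∎
    where open ℚ.≤-Reasoning

  *-rearrange : ∀ a b c d → a ℚ.* b ℚ.- c ℚ.* d ≡ a ℚ.* (b ℚ.- d) ℚ.+ d ℚ.* (a ℚ.- c)
  *-rearrange = solve 4 (λ a b c d →
    ((a :* b) :- (c :* d)) := ((a :* (b :- d)) :+ (d :* (a :- c)))) refl

  *-close : ∀ {B C δ} a b c d → 0ℚ ℚ.< B → 0ℚ ℚ.< C → ∣ a ∣ ℚ.≤ B → ∣ d ∣ ℚ.≤ C →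
            ∣ a ℚ.- c ∣ ℚ.≤ δ → ∣ b ℚ.- d ∣ ℚ.≤ δ →
            ∣ a ℚ.* b ℚ.- c ℚ.* d ∣ ℚ.≤ B ℚ.* δ ℚ.+ C ℚ.* δ
  *-close {B} {C} {δ} a b c d 0<B 0<C a≤B d≤C a-c≤δ b-d≤δ = begin
    ∣ a ℚ.* b ℚ.- c ℚ.* d ∣
      ≡⟨ cong ∣_∣ (*-rearrange a b c d) ⟩
    ∣ a ℚ.* (b ℚ.- d) ℚ.+ d ℚ.* (a ℚ.- c) ∣
      ≤⟨ ℚ.∣p+q∣≤∣p∣+∣q∣ (a ℚ.* (b ℚ.- d)) (d ℚ.* (a ℚ.- c)) ⟩
    ∣ a ℚ.* (b ℚ.- d) ∣ ℚ.+ ∣ d ℚ.* (a ℚ.- c) ∣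
      ≤⟨ ℚ.+-mono-≤ (∣*∣-mono a (b ℚ.- d) 0<B a≤B b-d≤δ)
                    (∣*∣-mono d (a ℚ.- c) 0<C d≤C a-c≤δ) ⟩
    B ℚ.* δ ℚ.+ C ℚ.* δ ∎
    where open ℚ.≤-Reasoning

  divide : ∀ ε D → 0ℚ ℚ.< ε → 0ℚ ℚ.< D → ∃[ δ ] (0ℚ ℚ.< δ × D ℚ.* δ ≡ ε)
  divide ε D 0<ε 0<D = D⁻¹ ℚ.* ε , ℚ.positive⁻¹ (D⁻¹ ℚ.* ε) , (begin
    D ℚ.* (D⁻¹ ℚ.* ε)  ≡⟨ ℚ.*-assoc D D⁻¹ ε ⟨
    D ℚ.* D⁻¹ ℚ.* ε    ≡⟨ cong (ℚ._* ε) (ℚ.*-inverseʳ D) ⟩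
    1ℚ ℚ.* ε           ≡⟨ ℚ.*-identityˡ ε ⟩
    ε                  ∎)
    where
    open ≡.≡-Reasoning
    instance
      D-positive : ℚ.Positive D
      D-positive = ℚ.positive 0<D
      D-nonZero : ℚ.NonZero D
      D-nonZero = ℚ.pos⇒nonZero D
    D⁻¹ : ℚ
    D⁻¹ = ℚ.1/ D
    instance
      D⁻¹*ε-positive : ℚ.Positive (D⁻¹ ℚ.* ε)
      D⁻¹*ε-positive =
        ℚ.pos*pos⇒pos D⁻¹ {{ℚ.1/pos⇒pos D}} ε {{ℚ.positive 0<ε}}

  *-cauchy : ∀ x y → IsCauchy x → IsCauchy y → IsCauchy (λ n → x n ℚ.* y n)
  *-cauchy x y cx cy ε 0<ε =
    let B , 0<B , J , bx = eventuallyBounded x cx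
        C , 0<C , L , by = eventuallyBounded y cy
        δ , 0<δ , eq     = divide ε (B ℚ.+ C) 0<ε (ℚ.+-mono-< 0<B 0<C)
        M , p            = cx δ 0<δ
        N , q            = cy δ 0<δ
    in (J ⊔ L) ⊔ (M ⊔ N) , λ m n m≥ n≥ →
      let m≥JL = ℕ.m⊔n≤o⇒m≤o (J ⊔ L) (M ⊔ N) m≥
          n≥JL = ℕ.m⊔n≤o⇒m≤o (J ⊔ L) (M ⊔ N) n≥
          m≥MN = ℕ.m⊔n≤o⇒n≤o (J ⊔ L) (M ⊔ N) m≥
          n≥MN = ℕ.m⊔n≤o⇒n≤o (J ⊔ L) (M ⊔ N) n≥
      in subst (∣ x m ℚ.* y m ℚ.- x n ℚ.* y n ∣ ℚ.≤_)
           (trans (≡.sym (ℚ.*-distribʳ-+ δ B C)) eq)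
           (*-close (x m) (y m) (x n) (y n) 0<B 0<C
             (bx m (ℕ.m⊔n≤o⇒m≤o J L m≥JL))
             (by n (ℕ.m⊔n≤o⇒n≤o J L n≥JL))
             (p m n (ℕ.m⊔n≤o⇒m≤o M N m≥MN) (ℕ.m⊔n≤o⇒m≤o M N n≥MN))
             (q m n (ℕ.m⊔n≤o⇒n≤o M N m≥MN) (ℕ.m⊔n≤o⇒n≤o M N n≥MN)))

  const-cauchy : ∀ q → IsCauchy (λ _ → q)
  const-cauchy q ε 0<ε = 0 , λ _ _ _ _ →
    subst (λ r → ∣ r ∣ ℚ.≤ ε) (≡.sym (ℚ.+-inverseʳ q)) (ℚ.<⇒≤ 0<ε)

_+ᴿ_ : ℝ → ℝ → ℝ
x +ᴿ y = mkℝ (λ n → seq x n ℚ.+ seq y n) (+-cauchy (seq x) (seq y) (cauchy x) (cauchy y))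

_*ᴿ_ : ℝ → ℝ → ℝ
x *ᴿ y = mkℝ (λ n → seq x n ℚ.* seq y n) (*-cauchy (seq x) (seq y) (cauchy x) (cauchy y))

fromℚ : ℚ → ℝ
fromℚ q = mkℝ (λ _ → q) (const-cauchy q)

fromℕ : ℕ → ℝ
fromℕ n = fromℚ (fromℤ (+ n))

0ᴿ 1ᴿ : ℝ
0ᴿ = fromℕ 0
1ᴿ = fromℕ 1

+ᴿ-0-rawMonoid : RawMonoid 0ℓ 0ℓ
+ᴿ-0-rawMonoid = record { Carrier = ℝ ; _≈_ = _≈ᴿ_ ; _∙_ = _+ᴿ_ ; ε = 0ᴿ }

open RawMonoidDefinitions +ᴿ-0-rawMonoid public using () renaming (sum to sumᴿ)

------------------------------------------------------------------------
-- Eigenvalues of real square matrices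

Vectorᴿ : ℕ → Set
Vectorᴿ n = Fin n → ℝ

Matrixᴿ : ℕ → Set
Matrixᴿ n = Fin n → Fin n → ℝ

_*ᵛ_ : ∀ {n} → Matrixᴿ n → Vectorᴿ n → Vectorᴿ n
(A *ᵛ v) i = sumᴿ (λ j → A i j *ᴿ v j)

IsEigenvalue : ∀ {n} → Matrixᴿ n → ℝ → Set
IsEigenvalue {n} A μ = ∃[ v ]
  (¬ (∀ i → v i ≈ᴿ 0ᴿ) × (∀ i → (A *ᵛ v) i ≈ᴿ μ *ᴿ v i))

IsLargestEigenvalue : ∀ {n} → Matrixᴿ n → ℝ → Set
IsLargestEigenvalue A ρ = IsEigenvalue A ρ × (∀ μ → IsEigenvalue A μ → μ ≤ᴿ ρ)

------------------------------------------------------------------------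
-- Simple graphs

record Graph (V : Set) : Set where
  field
    adj    : V → V → Bool
    sym    : ∀ u v → adj u v ≡ adj v u
    irrefl : ∀ v → adj v v ≡ false

open Graph public using (adj)

Edge : ∀ {V} → Graph V → V → V → Set
Edge G u v = adj G u v ≡ true

infix 4 _≐_ _≅_

-- Equality of graphs on a common vertex set: the same edges.  Without function
-- extensionality this is weaker than propositional equality of the records.
_≐_ : ∀ {V} → Graph V → Graph V → Set
G ≐ H = ∀ u v → adj G u v ≡ adj H u v

_≅_ : ∀ {V W} → Graph V → Graph W → Set
_≅_ {V} {W} G H = Σ[ f ∈ V ↔ W ]
  (∀ u v → adj G u v ≡ adj H (Inverse.to f u) (Inverse.to f v))

K : ∀ n → Graph (Fin n)
K n = record
  { adj    = λ u v → not (does (u Fin.≟ v))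
  ; sym    = λ u v → cong not (≟-sym u v)
  ; irrefl = λ v → cong not (dec-true (v Fin.≟ v) refl)
  }
  where
  ≟-sym : ∀ (u v : Fin n) → does (u Fin.≟ v) ≡ does (v Fin.≟ u)
  ≟-sym u v with u Fin.≟ v | v Fin.≟ u
  ... | yes _   | yes _   = refl
  ... | no  _   | no  _   = refl
  ... | yes u≡v | no  v≢u = contradiction (≡.sym u≡v) v≢u
  ... | no  u≢v | yes v≡u = contradiction (≡.sym v≡u) u≢v

sumAdj : ∀ {V W} → Bool → Graph V → Graph W → V ⊎ W → V ⊎ W → Bool
sumAdj b G H (inj₁ u) (inj₁ v) = adj G u v
sumAdj b G H (inj₂ u) (inj₂ v) = adj H u v
sumAdj b G H (inj₁ _) (inj₂ _) = b
sumAdj b G H (inj₂ _) (inj₁ _) = b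

-- b says whether vertices of different summands are adjacent.
graphSum : ∀ {V W} → Bool → Graph V → Graph W → Graph (V ⊎ W)
graphSum b G H = record
  { adj    = sumAdj b G H
  ; sym    = λ where
      (inj₁ u) (inj₁ v) → Graph.sym G u v
      (inj₂ u) (inj₂ v) → Graph.sym H u v
      (inj₁ _) (inj₂ _) → refl
      (inj₂ _) (inj₁ _) → refl
  ; irrefl = λ where
      (inj₁ v) → Graph.irrefl G v
      (inj₂ v) → Graph.irrefl H v
  }

infixr 6 _∪_ _∨_

_∪_ : ∀ {V W} → Graph V → Graph W → Graph (V ⊎ W)
_∪_ = graphSum false

_∨_ : ∀ {V W} → Graph V → Graph W → Graph (V ⊎ W)
_∨_ = graphSum true

adjacencyMatrix : ∀ {n} → Graph (Fin n) → Matrixᴿ n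
adjacencyMatrix G u v = if adj G u v then 1ᴿ else 0ᴿ

IsSpectralRadius : ∀ {n} → Graph (Fin n) → ℝ → Set
IsSpectralRadius G ρ = IsLargestEigenvalue (adjacencyMatrix G) ρ

------------------------------------------------------------------------
-- Rainbow Hamiltonian cycles

next : ∀ {n} → Fin n → Fin n
next {suc n} k = suc (toℕ k) mod suc n

-- The Hamiltonian cycle is π 0, π 1, …, π (n - 1), π 0, and its edge
-- e_i ∈ E(G_i) is the one joining π (σ i) to its successor π (σ i + 1).  For
-- n ≥ 3 these closed walks are exactly the Hamiltonian cycles and their n edges
-- are distinct; for smaller n the definition is not meaningful.
HasRainbowHamiltonianCycle : ∀ {n} → (Fin n → Graph (Fin n)) → Set
HasRainbowHamiltonianCycle {n} G =
  Σ[ π ∈ Permutation′ n ] Σ[ σ ∈ Permutation′ n ]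
    (∀ i → Edge (G i) (π ⟨$⟩ʳ (σ ⟨$⟩ʳ i)) (π ⟨$⟩ʳ next (σ ⟨$⟩ʳ i)))

{-# OPTIONS --safe #-}

-- The bound ρ(Gᵢ) > n - 2 enters only through the number of nonedges: for positive
-- weights w with wA ≤ cw no eigenvalue exceeds c (compare weighted ℓ¹ norms), and
-- wᵥ = n - 2 + deg v shows that every Gᵢ has at most n - 2 nonedges.
--
-- Let t(e) be the number of i for which e is a nonedge of Gᵢ.  Inserting the vertices
-- one by one, each at its best place, gives a Hamiltonian cycle with Σ t ≤ 2n - 3.  If
-- no edge of it has t = n, its edges can be labelled: on average a labelling has less than
-- two misfits, and a single misfit can be repaired by permuting two or three labels unless
-- Σ t ≥ 2n - 2.  If one edge xy has t = n, exchange it and another edge of the cycle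
-- (2-opt).  When no exchange helps, all estimates are tight, so all Gᵢ are equal and their
-- nonedges form a double star around xy.  Then there is a Hamiltonian cycle avoiding all
-- nonedges, unless the double star is a star, which is the exceptional family, or a
-- triangle with n = 5, whose complement has ρ = 3 = n - 2.

module Submission where

open import Defs
open import Data.Fin.Base using (Fin)
open import Data.Nat.Base using (ℕ; _≤_; _∸_)
open import Data.Product.Base using (_×_)
open import Relation.Nullary using (¬_)

open import Data.Bool.Base using (true; false; if_then_else_)
open import Data.Fin.Base as Fin using (zero; suc; inject₁; toℕ; splitAt; cast)
open import Data.List.Base as List
  using (List; []; _∷_; _++_; _∷ʳ_; [_]; map; length; reverse; allFin; tabulate; lookup;
    initLast; _∷ʳ′_)
import Data.List.Properties as List
open import Data.Nat.Base as ℕ using (zero; suc)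
open import Data.Nat.ListAction using (sum)
open import Data.Product.Base using (Σ; ∃; ∃₂; _,_; proj₁; proj₂; uncurry)
open import Function.Base using (_∘_; id)
open import Relation.Binary.PropositionalEquality
  using (_≡_; _≢_; refl; sym; trans; cong; cong₂; subst; subst₂; setoid; module ≡-Reasoning)

-- The count of nonedges is attained: in the exceptional family every graph has n - 2 of them, so t
-- sums to n(n - 2) over all pairs and no sharper count is available. A pair lies on the fraction
-- 2/(n - 1) of all Hamiltonian cycles, so their average weight is at most 2n(n - 2)/(n - 1) = 2n -
-- 2 - 2/(n - 1). The margin below 2n - 2 is less than one, and it is just what is needed: labelling
-- requires weight below 2n - 2, and such a cycle has room for one edge with t = n, but not for two.
-- The order on Cauchy reals is undecidable. The spectral hypothesis is therefore used only in the
-- form `¬ WeightsBounding`, the refutation of a certificate in natural numbers; all later case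
-- distinctions concern natural numbers and are decidable. To avoid subtraction, weight T ≤ 2n - 3
-- reads `T + 3 ≤ 2 * n`.

private variable
  A B : Set

∑ : List A → (A → ℕ) → ℕ
∑ xs f = sum (map f xs)

adjacency : ∀ {n} → Graph (Fin n) → Fin n → Fin n → ℕ
adjacency G u v = if adj G u v then 1 else 0

-- A Collatz-Wielandt certificate: positive weights with wA ≤ cw entrywise force every eigenvalue to
-- be at most c. Integral weights suffice for all graphs that have to be excluded.
WeightsBounding : ∀ {n} → ℕ → Graph (Fin n) → Set
WeightsBounding {n} c G = ∃ λ (w : Fin n → ℕ) → (∀ i → 1 ≤ w i) ×
  (∀ j → ∑ (allFin n) (λ i → w i ℕ.* adjacency G i j) ≤ c ℕ.* w j)

-- Weights bound the eigenvalues

module Eigenvalues where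

  open import Algebra.Bundles using (CommutativeRing)
  open import Data.Integer.Base as ℤ using (+_)
  import Data.Integer.Properties as ℤ
  import Data.Nat.Properties as ℕ
  open import Data.Rational.Base as ℚ hiding (_≤_)
  open import Data.Rational.Literals using (fromℤ)
  open import Data.Rational.Properties
  open import Data.Rational.Solver using (module +-*-Solver)
  import Data.Rational.Unnormalised.Base as ℚᵘ
  import Data.Rational.Unnormalised.Properties as ℚᵘ
  open import Algebra.Properties.CommutativeMonoid.Sum +-0-commutativeMonoid
    using (∑-distrib-+; ∑-comm; sum-cong-≗) renaming (sum to sumℚ)
  open import Algebra.Properties.Semiring.Sum (CommutativeRing.semiring +-*-commutativeRing)
    using (*-distribˡ-sum; *-distribʳ-sum)

  ι : ℕ → ℚ
  ι n = fromℤ (+ n)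

  ι-+ : ∀ m n → ι (m ℕ.+ n) ≡ ι m + ι n
  ι-+ m n = toℚᵘ-injective (ℚᵘ.≃-trans
    (ℚᵘ.*≡* (cong (ℤ._* + 1) (cong₂ ℤ._+_ (sym (ℤ.*-identityʳ (+ m))) (sym (ℤ.*-identityʳ (+ n))))))
    (ℚᵘ.≃-sym (toℚᵘ-homo-+ (ι m) (ι n))))

  ι-* : ∀ m n → ι (m ℕ.* n) ≡ ι m * ι n
  ι-* m n = toℚᵘ-injective (ℚᵘ.≃-trans
    (ℚᵘ.*≡* (cong (ℤ._* + 1) (ℤ.pos-* m n)))
    (ℚᵘ.≃-sym (toℚᵘ-homo-* (ι m) (ι n))))

  ι-mono : ∀ {m n} → m ≤ n → ι m ℚ.≤ ι n
  ι-mono {m} {n} m≤n = *≤* (ℤ.*-monoʳ-≤-nonNeg (+ 1) (ℤ.+≤+ m≤n))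

  ι-∑ : ∀ {n} (f : Fin n → ℕ) → ι (∑ (allFin n) f) ≡ sumℚ (λ i → ι (f i))
  ι-∑ {n} f = trans (cong (ι ∘ sum) (List.map-tabulate id f)) (go f)
    where
    go : ∀ {n} (f : Fin n → ℕ) → ι (sum (tabulate f)) ≡ sumℚ (λ i → ι (f i))
    go {zero}  f = refl
    go {suc n} f = trans (ι-+ (f zero) (sum (tabulate (f ∘ suc)))) (cong (_+_ (ι (f zero))) (go (f ∘ suc)))

  sum-mono : ∀ {n} {f g : Fin n → ℚ} → (∀ i → f i ℚ.≤ g i) → sumℚ f ℚ.≤ sumℚ g
  sum-mono {zero}  le = ≤-refl
  sum-mono {suc n} le = +-mono-≤ (le zero) (sum-mono (le ∘ suc))

  ∣sum∣≤sum : ∀ {n} (f : Fin n → ℚ) → ∣ sumℚ f ∣ ℚ.≤ sumℚ (λ i → ∣ f i ∣)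
  ∣sum∣≤sum {zero}  f = ≤-refl
  ∣sum∣≤sum {suc n} f = ≤-trans (∣p+q∣≤∣p∣+∣q∣ (f zero) (sumℚ (f ∘ suc)))
    (+-monoʳ-≤ ∣ f zero ∣ (∣sum∣≤sum (f ∘ suc)))

  sum-nonneg : ∀ {n} {f : Fin n → ℚ} → (∀ i → 0ℚ ℚ.≤ f i) → 0ℚ ℚ.≤ sumℚ f
  sum-nonneg {zero}  pos = ≤-refl
  sum-nonneg {suc n} pos = +-mono-≤ (pos zero) (sum-nonneg (pos ∘ suc))

  ≤sum : ∀ {n} {f : Fin n → ℚ} → (∀ i → 0ℚ ℚ.≤ f i) → ∀ i → f i ℚ.≤ sumℚ f
  ≤sum {suc n} {f} pos zero    = ≤-trans (≤-reflexive (sym (+-identityʳ (f zero))))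
    (+-monoʳ-≤ (f zero) (sum-nonneg (pos ∘ suc)))
  ≤sum {suc n} {f} pos (suc i) = ≤-trans (≤sum (pos ∘ suc) i)
    (≤-trans (≤-reflexive (sym (+-identityˡ _))) (+-monoˡ-≤ (sumℚ (f ∘ suc)) (pos zero)))

  *-monoʳ : ∀ {p q} r → 0ℚ ℚ.≤ r → p ℚ.≤ q → p * r ℚ.≤ q * r
  *-monoʳ r 0≤r = *-monoʳ-≤-nonNeg r {{nonNegative 0≤r}}

  *-monoˡ : ∀ {p q} r → 0ℚ ℚ.≤ r → p ℚ.≤ q → r * p ℚ.≤ r * q
  *-monoˡ r 0≤r = *-monoˡ-≤-nonNeg r {{nonNegative 0≤r}}

  0≤* : ∀ {p q} → 0ℚ ℚ.≤ p → 0ℚ ℚ.≤ q → 0ℚ ℚ.≤ p * q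
  0≤* {p} {q} 0≤p 0≤q = ≤-trans (≤-reflexive (sym (*-zeroˡ q))) (*-monoʳ q 0≤q 0≤p)

  -- An approximate eigenvector for an approximate eigenvalue above c is small in the
  -- weighted ℓ¹ norm, for any weights w with wA ℚ.≤ cw.
  module Approximate {n} (A : Fin n → Fin n → ℚ) (w : Fin n → ℚ) (c : ℚ)
    (0≤A : ∀ i j → 0ℚ ℚ.≤ A i j) (1≤w : ∀ i → 1ℚ ℚ.≤ w i) (0≤c : 0ℚ ℚ.≤ c)
    (wA≤cw : ∀ j → sumℚ (λ i → w i * A i j) ℚ.≤ c * w j) where

    approximate : ∀ (x : Fin n → ℚ) m ε δ → 0ℚ ℚ.≤ ε → c + ε ℚ.≤ m →
      (∀ i → ∣ sumℚ (λ j → A i j * x j) - m * x i ∣ ℚ.≤ δ) →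
      ∀ i → ε * ∣ x i ∣ ℚ.≤ sumℚ w * δ
    approximate x m ε δ 0≤ε c+ε≤m close i = begin
      ε * ∣ x i ∣  ≤⟨ *-monoˡ ε 0≤ε (≤-trans ∣x∣≤w∣x∣ (≤sum (λ i → 0≤* (0≤w i) (0≤∣p∣ (x i))) i)) ⟩
      ε * S        ≤⟨ εS≤ ⟩
      sumℚ w * δ    ∎
      where
      open ≤-Reasoning
      S = sumℚ (λ i → w i * ∣ x i ∣)
      0≤w : ∀ i → 0ℚ ℚ.≤ w i
      0≤w i = ≤-trans (<⇒≤ (positive⁻¹ 1ℚ)) (1≤w i)
      0≤m : 0ℚ ℚ.≤ m
      0≤m = ≤-trans (+-mono-≤ 0≤c 0≤ε) c+ε≤m
      ∣x∣≤w∣x∣ : ∣ x i ∣ ℚ.≤ w i * ∣ x i ∣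
      ∣x∣≤w∣x∣ = ≤-trans (≤-reflexive (sym (*-identityˡ ∣ x i ∣))) (*-monoʳ ∣ x i ∣ (0≤∣p∣ (x i)) (1≤w i))
      row : ∀ i → (c + ε) * ∣ x i ∣ ℚ.≤ sumℚ (λ j → A i j * ∣ x j ∣) + δ
      row i = begin
        (c + ε) * ∣ x i ∣
          ≤⟨ *-monoʳ ∣ x i ∣ (0≤∣p∣ (x i)) c+ε≤m ⟩
        m * ∣ x i ∣
          ≡⟨ cong (_* ∣ x i ∣) (0≤p⇒∣p∣≡p 0≤m) ⟨
        ∣ m ∣ * ∣ x i ∣
          ≡⟨ ∣p*q∣≡∣p∣*∣q∣ m (x i) ⟨
        ∣ m * x i ∣
          ≡⟨ cong ∣_∣ (eq (sumℚ (λ j → A i j * x j)) (m * x i)) ⟩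
        ∣ sumℚ (λ j → A i j * x j) - (sumℚ (λ j → A i j * x j) - m * x i) ∣
          ≤⟨ ∣p-q∣≤∣p∣+∣q∣ (sumℚ (λ j → A i j * x j)) _ ⟩
        ∣ sumℚ (λ j → A i j * x j) ∣ + ∣ sumℚ (λ j → A i j * x j) - m * x i ∣
          ≤⟨ +-mono-≤ (∣sum∣≤sum (λ j → A i j * x j)) (close i) ⟩
        sumℚ (λ j → ∣ A i j * x j ∣) + δ
          ≡⟨ cong (_+ δ) (sum-cong-≗ (λ j → trans (∣p*q∣≡∣p∣*∣q∣ (A i j) (x j))
               (cong (_* ∣ x j ∣) (0≤p⇒∣p∣≡p (0≤A i j))))) ⟩
        sumℚ (λ j → A i j * ∣ x j ∣) + δ ∎
        where
        open +-*-Solver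
        eq : ∀ s t → t ≡ s - (s - t)
        eq = solve 2 (λ s t → t := s :- (s :- t)) refl
      -- Weighting row i by `w i` and exchanging the sums lets A act on w instead of on the absolute
      -- values of x, so that wA ≤ cw applies; c * S then cancels.
      total : (c + ε) * S ℚ.≤ c * S + sumℚ w * δ
      total = begin
        (c + ε) * S
          ≡⟨ *-distribˡ-sum (c + ε) (λ i → w i * ∣ x i ∣) ⟩
        sumℚ (λ i → (c + ε) * (w i * ∣ x i ∣))
          ≡⟨ sum-cong-≗ (λ i → swap (c + ε) (w i) ∣ x i ∣) ⟩
        sumℚ (λ i → w i * ((c + ε) * ∣ x i ∣))
          ≤⟨ sum-mono (λ i → *-monoˡ (w i) (0≤w i) (row i)) ⟩
        sumℚ (λ i → w i * (sumℚ (λ j → A i j * ∣ x j ∣) + δ))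
          ≡⟨ sum-cong-≗ (λ i → *-distribˡ-+ (w i) (sumℚ (λ j → A i j * ∣ x j ∣)) δ) ⟩
        sumℚ (λ i → w i * sumℚ (λ j → A i j * ∣ x j ∣) + w i * δ)
          ≡⟨ ∑-distrib-+ (λ i → w i * sumℚ (λ j → A i j * ∣ x j ∣)) (λ i → w i * δ) ⟩
        sumℚ (λ i → w i * sumℚ (λ j → A i j * ∣ x j ∣)) + sumℚ (λ i → w i * δ)
          ≡⟨ cong₂ _+_ (sum-cong-≗ (λ i → *-distribˡ-sum (w i) (λ j → A i j * ∣ x j ∣))) (sym (*-distribʳ-sum δ w)) ⟩
        sumℚ (λ i → sumℚ (λ j → w i * (A i j * ∣ x j ∣))) + sumℚ w * δ
          ≡⟨ cong (_+ sumℚ w * δ) (∑-comm (λ i j → w i * (A i j * ∣ x j ∣))) ⟩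
        sumℚ (λ j → sumℚ (λ i → w i * (A i j * ∣ x j ∣))) + sumℚ w * δ
          ≡⟨ cong (_+ sumℚ w * δ) (sum-cong-≗ (λ j → trans
               (sum-cong-≗ (λ i → sym (*-assoc (w i) (A i j) ∣ x j ∣)))
               (sym (*-distribʳ-sum ∣ x j ∣ (λ i → w i * A i j))))) ⟩
        sumℚ (λ j → sumℚ (λ i → w i * A i j) * ∣ x j ∣) + sumℚ w * δ
          ≤⟨ +-monoˡ-≤ (sumℚ w * δ) (sum-mono (λ j → *-monoʳ ∣ x j ∣ (0≤∣p∣ (x j)) (wA≤cw j))) ⟩
        sumℚ (λ j → c * w j * ∣ x j ∣) + sumℚ w * δ
          ≡⟨ cong (_+ sumℚ w * δ) (sum-cong-≗ (λ j → *-assoc c (w j) ∣ x j ∣)) ⟩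
        sumℚ (λ j → c * (w j * ∣ x j ∣)) + sumℚ w * δ
          ≡⟨ cong (_+ sumℚ w * δ) (*-distribˡ-sum c (λ j → w j * ∣ x j ∣)) ⟨
        c * S + sumℚ w * δ ∎
        where
        open +-*-Solver
        swap : ∀ a b d → a * (b * d) ≡ b * (a * d)
        swap = solve 3 (λ a b d → a :* (b :* d) := b :* (a :* d)) refl
      εS≤ : ε * S ℚ.≤ sumℚ w * δ
      εS≤ = begin
        ε * S                          ≡⟨ eq₁ c ε S ⟩
        (c + ε) * S - c * S            ≤⟨ +-monoˡ-≤ (- (c * S)) total ⟩
        c * S + sumℚ w * δ - c * S      ≡⟨ eq₂ (c * S) (sumℚ w * δ) ⟩
        sumℚ w * δ                      ∎
        where
        open +-*-Solver
        eq₁ : ∀ c e s → e * s ≡ (c + e) * s - c * s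
        eq₁ = solve 3 (λ c e s → e :* s := (c :+ e) :* s :- c :* s) refl
        eq₂ : ∀ a b → a + b - a ≡ b
        eq₂ = solve 2 (λ a b → a :+ b :- a := b) refl

  uniformly : ∀ {n} {P : Fin n → ℕ → Set} → (∀ i → ∃ λ N → ∀ k → N ≤ k → P i k) →
    ∃ λ N → ∀ i k → N ≤ k → P i k
  uniformly {zero}  f = 0 , λ ()
  uniformly {suc n} f with f zero | uniformly (f ∘ suc)
  ... | M , p | N , q = M ℕ.⊔ N , λ where
    zero    k le → p k (ℕ.≤-trans (ℕ.m≤m⊔n M N) le)
    (suc i) k le → q i k (ℕ.≤-trans (ℕ.m≤n⊔m M N) le)

  seq-sum : ∀ {n} (f : Fin n → ℝ) k → seq (sumᴿ f) k ≡ sumℚ (λ i → seq (f i) k)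
  seq-sum {zero}  f k = refl
  seq-sum {suc n} f k = cong (_+_ (seq (f zero) k)) (seq-sum (f ∘ suc) k)

  seq-adjacency : ∀ {n} (G : Graph (Fin n)) u v k → seq (adjacencyMatrix G u v) k ≡ ι (adjacency G u v)
  seq-adjacency G u v k with adj G u v
  ... | true  = refl
  ... | false = refl

  seq-*ᵛ : ∀ {n} (G : Graph (Fin n)) v i k →
    seq ((adjacencyMatrix G *ᵛ v) i) k ≡ sumℚ (λ j → ι (adjacency G i j) * seq (v j) k)
  seq-*ᵛ G v i k = trans (seq-sum (λ j → adjacencyMatrix G i j *ᴿ v j) k)
    (sum-cong-≗ (λ j → cong (_* seq (v j) k) (seq-adjacency G i j k)))

  -- That v is nonzero is a negative statement, so it is enough to derive v ≈ 0. At every late index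
  -- the rational entries of v form an approximate eigenvector for a value at least c + ε;
  -- `approximate` bounds them by W * δ / ε, and the error δ can be made arbitrarily small.
  noEigenvalueAbove : ∀ {n} (G : Graph (Fin n)) c → WeightsBounding c G →
    ∀ {μ} → IsEigenvalue (adjacencyMatrix G) μ → ¬ (fromℕ c <ᴿ μ)
  noEigenvalueAbove {n} G c (w , 1≤w , wA≤cw) {μ} (v , v≉0 , Av≈μv) (ε , 0<ε , M , above) = v≉0 v≈0
    where
    A′ : Fin n → Fin n → ℚ
    A′ i j = ι (adjacency G i j)
    W : ℚ
    W = sumℚ (λ i → ι (w i))
    open Approximate A′ (λ i → ι (w i)) (ι c) (λ i j → ι-mono ℕ.z≤n) (λ i → ι-mono (1≤w i)) (ι-mono ℕ.z≤n)
      (λ j → subst₂ ℚ._≤_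
        (trans (ι-∑ (λ i → w i ℕ.* adjacency G i j)) (sum-cong-≗ (λ i → ι-* (w i) (adjacency G i j))))
        (ι-* c (w j)) (ι-mono (wA≤cw j)))
    Close : ℚ → Fin n → ℕ → Set
    Close δ i k = ∣ sumℚ (λ j → A′ i j * seq (v j) k) - seq μ k * seq (v i) k ∣ ℚ.≤ δ
    close : ∀ δ → 0ℚ < δ → ∀ i → ∃ λ N → ∀ k → N ≤ k → Close δ i k
    close δ 0<δ i = proj₁ (Av≈μv i δ 0<δ) , λ k le →
      subst (λ s → ∣ s - seq μ k * seq (v i) k ∣ ℚ.≤ δ) (seq-*ᵛ G v i k) (proj₂ (Av≈μv i δ 0<δ) k le)
    -- The index i shows that there is a weight at all, so W ≥ w i ≥ 1 can be inverted; over the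
    -- empty index set W would be 0.
    scale : Fin n → ∀ η → 0ℚ < η → ∃ λ δ → 0ℚ < δ × W * δ ≡ η
    scale i η 0<η = 1/ W * η
      , positive⁻¹ (1/ W * η) {{pos*pos⇒pos (1/ W) {{1/pos⇒pos W}} η {{positive 0<η}}}}
      , trans (sym (*-assoc W (1/ W) η)) (trans (cong (_* η) (*-inverseʳ W)) (*-identityˡ η))
      where
      instance
        W-positive : Positive W
        W-positive = positive (<-≤-trans (positive⁻¹ 1ℚ) (≤-trans (ι-mono (1≤w i))
          (≤sum (λ i → ι-mono {0} {w i} ℕ.z≤n) i)))
        W-nonZero : NonZero W
        W-nonZero = pos⇒nonZero W
    small : ∀ i η δ → W * δ ≡ ε * η → (∃ λ N → ∀ i k → N ≤ k → Close δ i k) →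
      ∃ λ N → ∀ k → N ≤ k → ∣ seq (v i) k - 0ℚ ∣ ℚ.≤ η
    small i η δ Wδ (N , p) = M ℕ.⊔ N , λ k le →
      ≤-trans (≤-reflexive (cong ∣_∣ (+-identityʳ (seq (v i) k))))
        (*-cancelˡ-≤-pos ε {{positive 0<ε}} (≤-trans
          (approximate (λ j → seq (v j) k) (seq μ k) ε δ (<⇒≤ 0<ε) (above k (ℕ.≤-trans (ℕ.m≤m⊔n M N) le))
            (λ j → p j k (ℕ.≤-trans (ℕ.m≤n⊔m M N) le)) i)
          (≤-reflexive Wδ)))
    v≈0 : ∀ i → v i ≈ᴿ 0ᴿ
    v≈0 i η 0<η =
      let δ , 0<δ , Wδ = scale i (ε * η)
            (positive⁻¹ (ε * η) {{pos*pos⇒pos ε {{positive 0<ε}} η {{positive 0<η}}}})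
      in small i η δ Wδ (uniformly {P = Close δ} (close δ 0<δ))

open Eigenvalues using (noEigenvalueAbove)

import Data.Fin.Permutation as Permutation
open Permutation using (Permutation; _⟨$⟩ʳ_; _⟨$⟩ˡ_; _∘ₚ_)
import Data.Fin.Properties as Fin
open import Data.Fin.Relation.Unary.Top using (view; ‵fromℕ; ‵inject₁)
open import Data.List.Membership.Propositional.Properties using (∈-allFin; ∈-lookup)
open import Data.List.Relation.Binary.Permutation.Homogeneous using (onIndices)
open import Data.List.Relation.Binary.Permutation.Propositional as ↭
  using (_↭_; ↭-refl; ↭-sym; ↭-trans; ↭-reflexive; prep; swap; ↭⇒↭ₛ)
import Data.List.Relation.Binary.Permutation.Propositional.Properties as Perm
import Data.List.Relation.Binary.Permutation.Setoid.Properties as PermSetoid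
open import Data.List.Relation.Unary.All using (All; []; _∷_)
import Data.List.Relation.Unary.All as All
import Data.List.Relation.Unary.All.Properties as All
open import Data.List.Relation.Unary.Any using (Any; here; there)
open import Data.Nat.Base
open import Data.Nat.DivMod using (n%n≡0; m<n⇒m%n≡m; m%n<n)
open import Data.Nat.ListAction.Properties using (sum-↭; sum-++)
open import Data.Nat.Properties
open import Data.Nat.Tactic.RingSolver using (solve-∀)
import Data.Product.Base as Product
open import Data.Sum.Base as Sum using (_⊎_; inj₁; inj₂; [_,_]′)
open import Data.Sum.Function.Propositional using (_⊎-↔_)
open import Function.Bundles using (_↔_; Inverse)
open import Function.Construct.Composition using (_↔-∘_)
open import Function.Construct.Identity using (↔-id)
open import Function.Construct.Symmetry using (↔-sym)
open import Relation.Nullary using (yes; no; does; contradiction)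
open import Relation.Nullary.Decidable using (dec-true; dec-false)

-- Linear arithmetic through the ring solver, with slack d.
≤-by : ∀ {a b x y} d → x ≤ y → a + y + d ≡ b + x → a ≤ b
≤-by {a} {b} {x} {y} d x≤y eq = +-cancelʳ-≤ y a b (begin
  a + y      ≤⟨ m≤m+n (a + y) d ⟩
  a + y + d  ≡⟨ eq ⟩
  b + x      ≤⟨ +-monoʳ-≤ b x≤y ⟩
  b + y      ∎)
  where open ≤-Reasoning

zero? : ∀ m → m ≡ 0 ⊎ 1 ≤ m
zero? zero    = inj₁ refl
zero? (suc m) = inj₂ (s≤s z≤n)

-- Sums over lists

∑-cong : ∀ (xs : List A) {f g : A → ℕ} → (∀ x → f x ≡ g x) → ∑ xs f ≡ ∑ xs g
∑-cong xs eq = cong sum (List.map-cong eq xs)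

∑-mono : ∀ (xs : List A) {f g : A → ℕ} → All (λ x → f x ≤ g x) xs → ∑ xs f ≤ ∑ xs g
∑-mono []       []       = z≤n
∑-mono (x ∷ xs) (p ∷ ps) = +-mono-≤ p (∑-mono xs ps)

∑-+ : ∀ (xs : List A) (f g : A → ℕ) → ∑ xs (λ x → f x + g x) ≡ ∑ xs f + ∑ xs g
∑-+ []       f g = refl
∑-+ (x ∷ xs) f g =
  trans (cong (f x + g x +_) (∑-+ xs f g)) (interchange (f x) (g x) (∑ xs f) (∑ xs g))
  where
  interchange : ∀ a b c d → a + b + (c + d) ≡ a + c + (b + d)
  interchange = solve-∀

∑-* : ∀ (xs : List A) c (f : A → ℕ) → ∑ xs (λ x → c * f x) ≡ c * ∑ xs f
∑-* []       c f = sym (*-zeroʳ c)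
∑-* (x ∷ xs) c f = trans (cong (c * f x +_) (∑-* xs c f)) (sym (*-distribˡ-+ c (f x) (∑ xs f)))

∑-const : ∀ (xs : List A) c → ∑ xs (λ _ → c) ≡ length xs * c
∑-const []       c = refl
∑-const (x ∷ xs) c = cong (c +_) (∑-const xs c)

∑-comm : ∀ (xs : List A) (ys : List B) (f : A → B → ℕ) →
  ∑ xs (λ x → ∑ ys (f x)) ≡ ∑ ys (λ y → ∑ xs (λ x → f x y))
∑-comm []       ys f = sym (trans (∑-const ys 0) (*-zeroʳ (length ys)))
∑-comm (x ∷ xs) ys f =
  trans (cong (∑ ys (f x) +_) (∑-comm xs ys f)) (sym (∑-+ ys (f x) _))

∑-++ : ∀ (xs ys : List A) (f : A → ℕ) → ∑ (xs ++ ys) f ≡ ∑ xs f + ∑ ys f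
∑-++ xs ys f = trans (cong sum (List.map-++ f xs ys)) (sum-++ (map f xs) (map f ys))

∑-map : ∀ (xs : List A) (g : A → B) (f : B → ℕ) → ∑ (map g xs) f ≡ ∑ xs (λ x → f (g x))
∑-map xs g f = cong sum (sym (List.map-∘ xs))

∑-↭ : ∀ {xs ys : List A} → xs ↭ ys → ∀ f → ∑ xs f ≡ ∑ ys f
∑-↭ p f = sum-↭ (Perm.map⁺ f p)

∑≡0 : ∀ (xs : List A) {f : A → ℕ} → All (λ x → f x ≡ 0) xs → ∑ xs f ≡ 0
∑≡0 []       []       = refl
∑≡0 (x ∷ xs) (p ∷ ps) = cong₂ _+_ p (∑≡0 xs ps)

∑≡0⇒All : ∀ (xs : List A) {f : A → ℕ} → ∑ xs f ≡ 0 → All (λ x → f x ≡ 0) xs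
∑≡0⇒All []       _  = []
∑≡0⇒All (x ∷ xs) {f} eq = m+n≡0⇒m≡0 (f x) eq ∷ ∑≡0⇒All xs (m+n≡0⇒n≡0 (f x) eq)

≤∑ : ∀ (xs : List A) (f : A → ℕ) → All (λ x → f x ≤ ∑ xs f) xs
≤∑ []       f = []
≤∑ (x ∷ xs) f = m≤m+n (f x) _ ∷ All.map (λ le → ≤-trans le (m≤n+m _ (f x))) (≤∑ xs f)

∑-tight : ∀ c (xs : List A) {f : A → ℕ} → All (λ x → c ≤ f x) xs →
  ∑ xs f ≤ c * length xs → All (λ x → f x ≡ c) xs
∑-tight c []       []       _ = []
∑-tight c (x ∷ xs) {f} (p ∷ ps) le =
  ≤-antisym (≤-by 0 (+-mono-≤ le lower) (eq₁ (f x) (∑ xs f) c (length xs))) p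
  ∷ ∑-tight c xs ps (≤-by 0 (+-mono-≤ le p) (eq₂ (f x) (∑ xs f) c (length xs)))
  where
  lower : c * length xs ≤ ∑ xs f
  lower = subst (_≤ ∑ xs f) (trans (∑-const xs c) (*-comm (length xs) c)) (∑-mono xs ps)
  eq₁ : ∀ a s c l → a + (c * suc l + s) + 0 ≡ c + (a + s + c * l)
  eq₁ = solve-∀
  eq₂ : ∀ a s c l → s + (c * suc l + a) + 0 ≡ c * l + (a + s + c)
  eq₂ = solve-∀

-- The form of search used in all case analyses below: the element found moves to the front, and
-- what remains is again a list to search.
extract : ∀ {P Q : A → Set} → (∀ x → P x ⊎ Q x) → ∀ xs →
  (∃₂ λ x ys → P x × xs ↭ x ∷ ys) ⊎ All Q xs
extract P⊎Q [] = inj₂ []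
extract P⊎Q (x ∷ xs) with P⊎Q x
... | inj₁ p = inj₁ (x , xs , p , ↭-refl)
... | inj₂ q with extract P⊎Q xs
...   | inj₁ (y , ys , p , xs↭) = inj₁ (y , x ∷ ys , p , ↭-trans (prep x xs↭) (swap x y ↭-refl))
...   | inj₂ qs = inj₂ (q ∷ qs)

-- Perfect matchings, as lists of (row , column) pairs

module Matching {R C : Set} (b : R → C → ℕ) where

  rows : List (R × C) → List R
  rows = map proj₁

  cols : List (R × C) → List C
  cols = map proj₂

  cost : List (R × C) → ℕ
  cost ps = ∑ ps (λ p → b (proj₁ p) (proj₂ p))

  total : List R → List C → ℕ
  total rs cs = ∑ rs (λ r → ∑ cs (b r))

  -- Either match r with c, or split one of the old pairs; the best of these
  -- choices is at most the average.
  insertPair : ∀ r c ps → ∃ λ ps′ → rows ps′ ↭ r ∷ rows ps × cols ps′ ↭ c ∷ cols ps ×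
    suc (length ps) * cost ps′ ≤
      length ps * cost ps + (b r c + ∑ ps (λ p → b r (proj₂ p) + b (proj₁ p) c))
  insertPair r c [] = (r , c) ∷ [] , ↭-refl , ↭-refl , ≤-reflexive (eq (b r c))
    where
    eq : ∀ x → 1 * (x + 0) ≡ 0 * 0 + (x + 0)
    eq = solve-∀
  insertPair r c ((r₁ , c₁) ∷ ps) with insertPair r c ps
  ... | ps″ , rows↭ , cols↭ , le with ≤-total (cost ((r₁ , c₁) ∷ ps″)) (cost ((r₁ , c) ∷ (r , c₁) ∷ ps))
  ...   | inj₁ ≤₁ = (r₁ , c₁) ∷ ps″
                  , ↭-trans (prep r₁ rows↭) (swap r₁ r ↭-refl)
                  , ↭-trans (prep c₁ cols↭) (swap c₁ c ↭-refl)
                  , ≤-by 0 (+-mono-≤ ≤₁ le)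
                      (eq (length ps) (b r₁ c₁) (cost ps″) (b r₁ c) (b r c₁) (cost ps) (b r c) _)
    where
    eq : ∀ l x y p q C z s →
      suc (suc l) * (x + y) + (p + (q + C) + (l * C + (z + s))) + 0 ≡
      suc l * (x + C) + (z + (q + p + s)) + (x + y + suc l * y)
    eq = solve-∀
  ...   | inj₂ ≤₂ = (r₁ , c) ∷ (r , c₁) ∷ ps
                  , swap r₁ r ↭-refl
                  , ↭-refl
                  , ≤-by 0 (+-mono-≤ (*-monoʳ-≤ (suc (length ps)) ≤₂) le)
                      (eq (length ps) (b r₁ c₁) (cost ps″) (b r₁ c) (b r c₁) (cost ps) (b r c) _)
    where
    eq : ∀ l x y p q C z s →
      suc (suc l) * (p + (q + C)) + (suc l * (x + y) + (l * C + (z + s))) + 0 ≡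
      suc l * (x + C) + (z + (q + p + s)) + (suc l * (p + (q + C)) + suc l * y)
    eq = solve-∀

  -- The bound is the average cost over all matchings. In `insertPair` the old cost has the factor
  -- `length ps`, which is exactly the multiple that the induction hypothesis controls.
  cheapMatching : ∀ rs cs → length rs ≡ length cs → ∃ λ ps →
    rows ps ↭ rs × cols ps ↭ cs × length rs * cost ps ≤ total rs cs
  cheapMatching []       []       _  = [] , ↭-refl , ↭-refl , z≤n
  cheapMatching (r ∷ rs) (c ∷ cs) eq with cheapMatching rs cs (suc-injective eq)
  ... | ps , rows↭ , cols↭ , le with insertPair r c ps
  ...   | ps′ , rows′↭ , cols′↭ , le′ =
      ps′ , ↭-trans rows′↭ (prep r rows↭) , ↭-trans cols′↭ (prep c cols↭)
    , (begin
        suc (length rs) * cost ps′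
          ≡⟨ cong (λ l → suc l * cost ps′) lengths ⟨
        suc (length ps) * cost ps′
          ≤⟨ le′ ⟩
        length ps * cost ps + (b r c + ∑ ps (λ p → b r (proj₂ p) + b (proj₁ p) c))
          ≡⟨ cong₂ (λ l s → l * cost ps + (b r c + s)) lengths new ⟩
        length rs * cost ps + (b r c + (∑ cs (b r) + ∑ rs (λ r′ → b r′ c)))
          ≤⟨ +-monoˡ-≤ _ le ⟩
        total rs cs + (b r c + (∑ cs (b r) + ∑ rs (λ r′ → b r′ c)))
          ≡⟨ arrange (total rs cs) (b r c) (∑ cs (b r)) (∑ rs (λ r′ → b r′ c)) ⟩
        b r c + ∑ cs (b r) + (∑ rs (λ r′ → b r′ c) + total rs cs)
          ≡⟨ cong (b r c + ∑ cs (b r) +_) (∑-+ rs (λ r′ → b r′ c) (λ r′ → ∑ cs (b r′))) ⟨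
        total (r ∷ rs) (c ∷ cs) ∎)
    where
    open ≤-Reasoning
    lengths : length ps ≡ length rs
    lengths = trans (sym (List.length-map proj₁ ps)) (Perm.↭-length rows↭)
    new : ∑ ps (λ p → b r (proj₂ p) + b (proj₁ p) c) ≡ ∑ cs (b r) + ∑ rs (λ r′ → b r′ c)
    new = trans (∑-+ ps (λ p → b r (proj₂ p)) (λ p → b (proj₁ p) c))
      (cong₂ _+_ (trans (sym (∑-map ps proj₂ (b r))) (∑-↭ cols↭ (b r)))
                 (trans (sym (∑-map ps proj₁ (λ r′ → b r′ c))) (∑-↭ rows↭ (λ r′ → b r′ c))))
    arrange : ∀ t x y z → t + (x + (y + z)) ≡ x + y + (z + t)
    arrange = solve-∀

  PerfectMatching : List R → List C → Set
  PerfectMatching rs cs = ∃ λ ps → rows ps ↭ rs × cols ps ↭ cs ×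
    All (λ p → b (proj₁ p) (proj₂ p) ≡ 0) ps

  total-↭ : ∀ {rs rs′ cs cs′} → rs ↭ rs′ → cs ↭ cs′ → total rs cs ≡ total rs′ cs′
  total-↭ {rs} {cs′ = cs′} p q =
    trans (∑-cong rs (λ r → ∑-↭ q (b r))) (∑-↭ p (λ r → ∑ cs′ (b r)))

  private
    toThird : ∀ {X : Set} (x y z : X) {xs} → x ∷ y ∷ z ∷ xs ↭ y ∷ z ∷ x ∷ xs
    toThird x y z = ↭-trans (swap x y ↭-refl) (prep y (swap x z ↭-refl))

    Fits : R → C → Set
    Fits r c = b r c ≡ 0

    AllFit : List (R × C) → Set
    AllFit = All (λ p → b (proj₁ p) (proj₂ p) ≡ 0)

    swap₂ : ∀ {i e k f qs rs cs} → i ∷ k ∷ rows qs ↭ rs → e ∷ f ∷ cols qs ↭ cs →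
      Fits i f → Fits k e → AllFit qs → PerfectMatching rs cs
    swap₂ {i} {e} {k} {f} {qs} r c if ke fit =
      (i , f) ∷ (k , e) ∷ qs , r , ↭-trans (swap f e ↭-refl) c , if ∷ ke ∷ fit

    rotate₃ : ∀ {i e k f j g qs rs cs} → i ∷ k ∷ j ∷ rows qs ↭ rs → e ∷ f ∷ g ∷ cols qs ↭ cs →
      Fits i f → Fits k g → Fits j e → AllFit qs → PerfectMatching rs cs
    rotate₃ {i} {e} {k} {f} {j} {g} {qs} r c if kg je fit =
      (i , f) ∷ (k , g) ∷ (j , e) ∷ qs , r
      , ↭-trans (↭-trans (prep f (swap g e ↭-refl)) (swap f e ↭-refl)) c
      , if ∷ kg ∷ je ∷ fit

  module _ (rs : List R) (cs : List C) (lengths : length rs ≡ length cs)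
    (few : total rs cs + 3 ≤ 2 * length rs)
    (rowFits : ∀ r → ¬ All (λ c → 1 ≤ b r c) cs)
    (colFits : ∀ c → ¬ All (λ r → 1 ≤ b r c) rs)
    where

    private
      -- A pair in qs that offers no repair has two misfits with i, k, e and g.
      -- Together with the four given ones that is more than the total allows.
      blocked : ∀ {i e k f j g qs} → i ∷ k ∷ j ∷ rows qs ↭ rs → e ∷ f ∷ g ∷ cols qs ↭ cs →
        Fits i f → Fits j e → Fits k f → Fits j g → AllFit qs →
        1 ≤ b i e → 1 ≤ b k e → 1 ≤ b i g → 1 ≤ b k g → PerfectMatching rs cs
      blocked {i} {e} {k} {f} {j} {g} {qs} r↭ c↭ if je kf jg fit bie bke big bkg
        with extract {P = Repair} {Q = λ p → 2 ≤ misfits p} repair? qs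
        where
        misfits : R × C → ℕ
        misfits (l , c) = b i c + b k c + (b l e + b l g)
        Repair : R × C → Set
        -- The three repairs give c to i and e to l; or f to i, c to k and e to l; or c to i, g to l
        -- and e to j.
        Repair (l , c) = (Fits i c × Fits l e) ⊎ (Fits k c × Fits l e) ⊎ (Fits i c × Fits l g)
        repair? : ∀ p → Repair p ⊎ 2 ≤ misfits p
        repair? (l , c) with zero? (b i c) | zero? (b k c) | zero? (b l e) | zero? (b l g)
        ... | inj₁ p | _      | inj₁ q | _      = inj₁ (inj₁ (p , q))
        ... | _      | inj₁ p | inj₁ q | _      = inj₁ (inj₂ (inj₁ (p , q)))
        ... | inj₁ p | _      | _      | inj₁ q = inj₁ (inj₂ (inj₂ (p , q)))
        ... | inj₁ p | _      | inj₂ x | inj₂ y = inj₂ (≤-trans (+-mono-≤ x y) (m≤n+m _ (b i c + b k c)))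
        ... | inj₂ x | inj₂ y | _      | _      = inj₂ (≤-trans (+-mono-≤ x y) (m≤m+n _ _))
        ... | inj₂ x | inj₁ _ | inj₂ y | _      =
          inj₂ (+-mono-≤ (≤-trans x (m≤m+n _ _)) (≤-trans y (m≤m+n _ _)))
      ... | inj₁ ((l , c) , qs′ , p , qs↭)
          = finish p (Perm.All-resp-↭ qs↭ fit)
            (↭-trans (prep i (prep k (prep j (Perm.map⁺ proj₁ (↭-sym qs↭))))) r↭)
            (↭-trans (prep e (prep f (prep g (Perm.map⁺ proj₂ (↭-sym qs↭))))) c↭)
        where
        finish : (Fits i c × Fits l e) ⊎ (Fits k c × Fits l e) ⊎ (Fits i c × Fits l g) →
          AllFit ((l , c) ∷ qs′) → i ∷ k ∷ j ∷ l ∷ rows qs′ ↭ rs → e ∷ f ∷ g ∷ c ∷ cols qs′ ↭ cs →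
          PerfectMatching rs cs
        finish (inj₁ (ic , le)) (_ ∷ fit′) r c′ =
          swap₂ {k = l} {c} {(k , f) ∷ (j , g) ∷ qs′}
            (↭-trans (prep i (toThird l k j)) r) (↭-trans (prep e (toThird c f g)) c′)
            ic le (kf ∷ jg ∷ fit′)
        finish (inj₂ (inj₁ (kc , le))) (_ ∷ fit′) r c′ =
          rotate₃ {qs = (j , g) ∷ qs′}
            (↭-trans (prep i (prep k (swap l j ↭-refl))) r)
            (↭-trans (prep e (prep f (swap c g ↭-refl))) c′)
            if kc le (jg ∷ fit′)
        finish (inj₂ (inj₂ (ic , lg))) (_ ∷ fit′) r c′ =
          rotate₃ {k = l} {f = c} {j = j} {g = g} {qs = (k , f) ∷ qs′}
            (↭-trans (prep i (↭-trans (toThird l j k) (swap j k ↭-refl))) r)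
            (↭-trans (prep e (↭-trans (toThird c g f) (swap g f ↭-refl))) c′)
            ic lg je (kf ∷ fit′)
      ... | inj₂ full = contradiction (begin
          2 * length rs + 1
            ≡⟨ cong (λ l → 2 * l + 1) (sym (trans (cong (3 +_) (sym (List.length-map proj₁ qs))) (Perm.↭-length r↭))) ⟩
          2 * (3 + length qs) + 1
            ≡⟨ eq₁ (length qs) ⟩
          1 + 1 + (1 + 1) + length qs * 2 + 3
            ≤⟨ +-monoˡ-≤ 3 (+-mono-≤ (+-mono-≤ (+-mono-≤ bie big) (+-mono-≤ bke bkg)) many) ⟩
          b i e + b i g + (b k e + b k g) + (∑ qs (λ p → b i (proj₂ p)) + ∑ qs (λ p → b k (proj₂ p))
              + ∑ qs (λ p → b (proj₁ p) e + b (proj₁ p) g)) + 3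
            ≤⟨ +-monoˡ-≤ 3 cells ⟩
          total rs cs + 3
            ≤⟨ few ⟩
          2 * length rs ∎) (<⇒≱ (≤-reflexive (+-comm 1 _)))
        where
        open ≤-Reasoning
        eq₁ : ∀ l → 2 * (3 + l) + 1 ≡ 1 + 1 + (1 + 1) + l * 2 + 3
        eq₁ = solve-∀
        many : length qs * 2 ≤ ∑ qs (λ p → b i (proj₂ p)) + ∑ qs (λ p → b k (proj₂ p))
              + ∑ qs (λ p → b (proj₁ p) e + b (proj₁ p) g)
        many = begin
          length qs * 2
            ≡⟨ ∑-const qs 2 ⟨
          ∑ qs (λ _ → 2)
            ≤⟨ ∑-mono qs full ⟩
          ∑ qs (λ p → b i (proj₂ p) + b k (proj₂ p) + (b (proj₁ p) e + b (proj₁ p) g))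
            ≡⟨ ∑-+ qs (λ p → b i (proj₂ p) + b k (proj₂ p)) (λ p → b (proj₁ p) e + b (proj₁ p) g) ⟩
          ∑ qs (λ p → b i (proj₂ p) + b k (proj₂ p)) + ∑ qs (λ p → b (proj₁ p) e + b (proj₁ p) g)
            ≡⟨ cong (_+ ∑ qs (λ p → b (proj₁ p) e + b (proj₁ p) g))
                 (∑-+ qs (λ p → b i (proj₂ p)) (λ p → b k (proj₂ p))) ⟩
          ∑ qs (λ p → b i (proj₂ p)) + ∑ qs (λ p → b k (proj₂ p))
            + ∑ qs (λ p → b (proj₁ p) e + b (proj₁ p) g) ∎
        row : ∀ r → b r e + b r g + ∑ qs (λ p → b r (proj₂ p)) ≤ ∑ (e ∷ f ∷ g ∷ cols qs) (b r)
        row r = ≤-by (b r f) (≤-reflexive (sym (∑-map qs proj₂ (b r))))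
          (eq₂ (b r e) (b r f) (b r g) (∑ (cols qs) (b r)) _)
          where
          eq₂ : ∀ x y z s s′ → x + z + s′ + s + y ≡ x + (y + (z + s)) + s′
          eq₂ = solve-∀
        -- Rows i and k are counted outside column f, the rows of qs only in columns e and g, so no
        -- cell counts twice.
        cells : b i e + b i g + (b k e + b k g) + (∑ qs (λ p → b i (proj₂ p))
            + ∑ qs (λ p → b k (proj₂ p)) + ∑ qs (λ p → b (proj₁ p) e + b (proj₁ p) g)) ≤ total rs cs
        cells = begin
          b i e + b i g + (b k e + b k g) + (∑ qs (λ p → b i (proj₂ p))
            + ∑ qs (λ p → b k (proj₂ p)) + ∑ qs (λ p → b (proj₁ p) e + b (proj₁ p) g))
            ≡⟨ eq₃ (b i e + b i g) (b k e + b k g) _ _ _ ⟩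
          b i e + b i g + ∑ qs (λ p → b i (proj₂ p)) + (b k e + b k g + ∑ qs (λ p → b k (proj₂ p))
            + ∑ qs (λ p → b (proj₁ p) e + b (proj₁ p) g))
            ≤⟨ +-mono-≤ (row i) (+-mono-≤ (row k) (≤-trans others (m≤n+m _ _))) ⟩
          total (i ∷ k ∷ j ∷ rows qs) (e ∷ f ∷ g ∷ cols qs)
            ≡⟨ total-↭ r↭ c↭ ⟩
          total rs cs ∎
          where
          eq₃ : ∀ x y u v w → x + y + (u + v + w) ≡ x + u + (y + v + w)
          eq₃ = solve-∀
          others : ∑ qs (λ p → b (proj₁ p) e + b (proj₁ p) g) ≤ total (rows qs) (e ∷ f ∷ g ∷ cols qs)
          others = begin
            ∑ qs (λ p → b (proj₁ p) e + b (proj₁ p) g)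
              ≡⟨ ∑-map qs proj₁ (λ r → b r e + b r g) ⟨
            ∑ (rows qs) (λ r → b r e + b r g)
              ≤⟨ ∑-mono (rows qs) (All.universal (λ r → ≤-trans (m≤m+n _ _) (row r)) (rows qs)) ⟩
            total (rows qs) (e ∷ f ∷ g ∷ cols qs) ∎

    -- The average leaves at most one misfit (i , e). Row i is not full, so some pair (k , f) has f
    -- fitting i; column e is not full, so some (j , g) has j fitting e. Either these pairs permit
    -- an exchange, or all four cells in rows i, k and columns e, g are misfits, which is the
    -- situation of `blocked`.
    perfectMatching : PerfectMatching rs cs
    perfectMatching with cheapMatching rs cs lengths
    ... | ps , r↭ , c↭ , cheap with extract (λ p → Sum.swap (zero? (b (proj₁ p) (proj₂ p)))) ps
    ...   | inj₂ fit = ps , r↭ , c↭ , fit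
    ...   | inj₁ ((i , e) , qs , bie , ps↭) = search
      where
      atMostOne : cost ps ≤ 1
      atMostOne with cost ps ≤? 1
      ... | yes le = le
      ... | no ≰1 = contradiction
        (≤-trans (+-monoˡ-≤ 3 (≤-trans (*-monoʳ-≤ (length rs) (≰⇒> ≰1)) cheap)) few)
        (<⇒≱ (≤-trans (m<m+n _ (s≤s z≤n)) (≤-reflexive (cong (_+ 3) (*-comm 2 (length rs))))))
      fit : AllFit qs
      fit = ∑≡0⇒All qs (n≤0⇒n≡0 (+-cancelˡ-≤ 1 _ _ (begin
        1 + cost qs      ≤⟨ +-monoˡ-≤ (cost qs) bie ⟩
        b i e + cost qs  ≡⟨ ∑-↭ ps↭ (λ p → b (proj₁ p) (proj₂ p)) ⟨
        cost ps          ≤⟨ atMostOne ⟩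
        1                ∎)))
        where open ≤-Reasoning
      rows↭ : i ∷ rows qs ↭ rs
      rows↭ = ↭-trans (Perm.map⁺ proj₁ (↭-sym ps↭)) r↭
      cols↭ : e ∷ cols qs ↭ cs
      cols↭ = ↭-trans (Perm.map⁺ proj₂ (↭-sym ps↭)) c↭
      search : PerfectMatching rs cs
      search with extract (λ p → zero? (b i (proj₂ p))) qs
      ... | inj₂ full = contradiction (Perm.All-resp-↭ cols↭ (bie ∷ All.map⁺ full)) (rowFits i)
      ... | inj₁ ((k , f) , qs₁ , bif , qs↭) with zero? (b k e) | Perm.All-resp-↭ qs↭ fit
      ...   | inj₁ bke | _ ∷ fit₁ =
        swap₂ (↭-trans (prep i (Perm.map⁺ proj₁ (↭-sym qs↭))) rows↭)
              (↭-trans (prep e (Perm.map⁺ proj₂ (↭-sym qs↭))) cols↭) bif bke fit₁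
      ...   | inj₂ bke | bkf ∷ fit₁ with extract (λ p → zero? (b (proj₁ p) e)) qs₁
      ...     | inj₂ full = contradiction
        (Perm.All-resp-↭ (↭-trans (prep i (Perm.map⁺ proj₁ (↭-sym qs↭))) rows↭)
          (bie ∷ bke ∷ All.map⁺ full)) (colFits e)
      ...     | inj₁ ((j , g) , qs₂ , bje , qs₁↭)
        with ↭-trans (prep i (Perm.map⁺ proj₁ (↭-trans (prep _ (↭-sym qs₁↭)) (↭-sym qs↭)))) rows↭
           | ↭-trans (prep e (Perm.map⁺ proj₂ (↭-trans (prep _ (↭-sym qs₁↭)) (↭-sym qs↭)))) cols↭
           | Perm.All-resp-↭ qs₁↭ fit₁
      ...     | r₃ | c₃ | bjg ∷ fit₂ with zero? (b i g) | zero? (b k g)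
      ...       | inj₁ big | _ =
        swap₂ {qs = (k , f) ∷ qs₂} (↭-trans (prep i (swap j k ↭-refl)) r₃)
              (↭-trans (prep e (swap g f ↭-refl)) c₃) big bje (bkf ∷ fit₂)
      ...       | inj₂ _   | inj₁ bkg = rotate₃ r₃ c₃ bif bkg bje fit₂
      ...       | inj₂ big | inj₂ bkg = blocked r₃ c₃ bif bje bkf bjg fit₂ bie bke big bkg

-- Cycles, as lists of vertices up to rotation

module Cycles {V : Set} where

  steps : V → List V → V → List (V × V)
  steps a []       b = [ (a , b) ]
  steps a (z ∷ zs) b = (a , z) ∷ steps z zs b

  cycle : List V → List (V × V)
  cycle []       = []
  cycle (x ∷ xs) = steps x xs x

  steps-++ : ∀ a us v vs b → steps a (us ++ v ∷ vs) b ≡ steps a us v ++ steps v vs b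
  steps-++ a []       v vs b = refl
  steps-++ a (u ∷ us) v vs b = cong ((a , u) ∷_) (steps-++ u us v vs b)

  steps-reverse : ∀ a zs b → steps b (reverse zs) a ↭ map Product.swap (steps a zs b)
  steps-reverse a []       b = ↭-refl
  steps-reverse a (z ∷ zs) b
    rewrite List.unfold-reverse z zs | steps-++ b (reverse zs) z [] a
    = ↭-trans (↭-sym (Perm.∷↭∷ʳ (z , a) (steps b (reverse zs) z))) (prep (z , a) (steps-reverse z zs b))

  map-proj₁-steps : ∀ a zs b → map proj₁ (steps a zs b) ≡ a ∷ zs
  map-proj₁-steps a []       b = refl
  map-proj₁-steps a (z ∷ zs) b = cong (a ∷_) (map-proj₁-steps z zs b)

  map-proj₂-steps : ∀ a zs b → map proj₂ (steps a zs b) ≡ zs ∷ʳ b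
  map-proj₂-steps a []       b = refl
  map-proj₂-steps a (z ∷ zs) b = cong (z ∷_) (map-proj₂-steps z zs b)

  length-steps : ∀ a zs b → length (steps a zs b) ≡ suc (length zs)
  length-steps a []       b = refl
  length-steps a (z ∷ zs) b = cong suc (length-steps z zs b)

  cycle-rotate : ∀ us vs → cycle (us ++ vs) ↭ cycle (vs ++ us)
  cycle-rotate []       vs rewrite List.++-identityʳ vs = ↭-refl
  cycle-rotate (u ∷ us) [] rewrite List.++-identityʳ us = ↭-refl
  cycle-rotate (u ∷ us) (v ∷ vs) rewrite steps-++ u us v vs u | steps-++ v vs u us v =
    Perm.++-comm (steps u us v) (steps v vs u)

  -- Here u is the last vertex of a ∷ us and v the first of vs ∷ʳ b, so either may be an end of the
  -- path. The fields `left` and `right` hold for every c, so that both pieces can be glued to a new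
  -- vertex.
  record SplitAt (P : V × V → Set) (a : V) (zs : List V) (b : V) : Set where
    constructor cutAt
    field
      us vs  : List V
      u v    : V
      before after : List (V × V)
      p      : P (u , v)
      zs≡    : zs ≡ us ++ vs
      steps≡ : steps a zs b ≡ before ++ (u , v) ∷ after
      left   : ∀ c → steps a us c ≡ before ∷ʳ (u , c)
      right  : ∀ c → steps c vs b ≡ (c , v) ∷ after

  split : ∀ {P} a zs b → Any P (steps a zs b) → SplitAt P a zs b
  split a []       b (here p)  = cutAt [] [] a b [] [] p refl refl (λ _ → refl) (λ _ → refl)
  split a (z ∷ zs) b (here p)  =
    cutAt [] (z ∷ zs) a z [] (steps z zs b) p refl refl (λ _ → refl) (λ _ → refl)
  split a (z ∷ zs) b (there q) with split z zs b q
  ... | cutAt us vs u v bs as p zs≡ steps≡ left right =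
    cutAt (z ∷ us) vs u v ((a , z) ∷ bs) as p (cong (z ∷_) zs≡) (cong ((a , z) ∷_) steps≡)
      (λ c → cong ((a , z) ∷_) (left c)) right

  -- Weighted cycles: averaging and 2-opt

  module Weighted (w : V → V → ℕ) (w-sym : ∀ u v → w u v ≡ w v u) (w-irrefl : ∀ v → w v v ≡ 0) where

    weight : List (V × V) → ℕ
    weight es = ∑ es (uncurry w)

    path : V → List V → V → ℕ
    path a zs b = weight (steps a zs b)

    pairs : List V → ℕ
    pairs []       = 0
    pairs (x ∷ xs) = ∑ xs (w x) + pairs xs

    pairs-↭ : ∀ {xs ys} → xs ↭ ys → pairs xs ≡ pairs ys
    pairs-↭ ↭.refl         = refl
    pairs-↭ (prep x p)   = cong₂ _+_ (∑-↭ p (w x)) (pairs-↭ p)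
    pairs-↭ {xs = _ ∷ _ ∷ xs} {ys = _ ∷ _ ∷ ys} (swap x y p)
      rewrite ∑-↭ p (w x) | ∑-↭ p (w y) | pairs-↭ p | w-sym x y =
      eq (w y x) (∑ ys (w x)) (∑ ys (w y)) (pairs ys)
      where
      eq : ∀ a b c d → a + b + (c + d) ≡ a + c + (b + d)
      eq = solve-∀
    pairs-↭ (↭.trans p q)  = trans (pairs-↭ p) (pairs-↭ q)

    double-pairs : ∀ xs → ∑ xs (λ x → ∑ xs (w x)) ≡ 2 * pairs xs
    double-pairs [] = refl
    double-pairs (x ∷ xs)
      rewrite w-irrefl x | ∑-+ xs (λ y → w y x) (λ y → ∑ xs (w y)) | double-pairs xs
            | ∑-cong xs (λ y → w-sym y x) = eq (∑ xs (w x)) (pairs xs)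
      where
      eq : ∀ a b → a + (a + 2 * b) ≡ 2 * (a + b)
      eq = solve-∀

    weight-swap : ∀ es → weight (map Product.swap es) ≡ weight es
    weight-swap es = trans (∑-map es Product.swap (uncurry w)) (∑-cong es (λ e → w-sym (proj₂ e) (proj₁ e)))

    -- Among all places, v can be inserted at one whose cost is at most the average.
    insertVertex : ∀ v a zs b → ∃ λ zs′ → zs′ ↭ v ∷ zs ×
      suc (length zs) * path a zs′ b + path a zs b ≤
        suc (length zs) * path a zs b + (w v a + 2 * ∑ zs (w v) + w v b)
    insertVertex v a [] b rewrite w-sym v a =
      [ v ] , ↭-refl , ≤-reflexive (eq (w a v) (w v b) (w a b))
      where
      eq : ∀ p q r → 1 * (p + (q + 0)) + (r + 0) ≡ 1 * (r + 0) + (p + 0 + q)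
      eq = solve-∀
    insertVertex v a (z ∷ zs) b
      rewrite w-sym v a
      with insertVertex v z zs b
    ... | zs′ , zs′↭ , le with ≤-total (w a z + path z zs′ b) (path a (v ∷ z ∷ zs) b)
    ...   | inj₁ ≤₁ = z ∷ zs′ , ↭-trans (prep z zs′↭) (swap z v ↭-refl)
                    , ≤-by 0 (+-mono-≤ ≤₁ le)
                        (eq (length zs) (w a z) (path z zs′ b) (path z zs b)
                            (w a v) (w v z) (∑ zs (w v)) (w v b))
      where
      eq : ∀ l r x y p q s t →
        suc (suc l) * (r + x) + (r + y) + (p + (q + y) + (suc l * y + (q + 2 * s + t))) + 0 ≡
        suc (suc l) * (r + y) + (p + 2 * (q + s) + t) + (r + x + (suc l * x + y))
      eq = solve-∀
    ...   | inj₂ ≤₂ = v ∷ z ∷ zs , ↭-refl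
                    , ≤-by 0 (+-mono-≤ (*-monoʳ-≤ (suc (length zs)) ≤₂) le)
                        (eq (length zs) (w a z) (path z zs′ b) (path z zs b)
                            (w a v) (w v z) (∑ zs (w v)) (w v b))
      where
      eq : ∀ l r x y p q s t →
        suc (suc l) * (p + (q + y)) + (r + y) + (suc l * (r + x) + (suc l * y + (q + 2 * s + t)))
          + 0 ≡
        suc (suc l) * (r + y) + (p + 2 * (q + s) + t) + (suc l * (p + (q + y)) + (suc l * x + y))
      eq = solve-∀

    -- The bound is the average over all Hamiltonian cycles. A single vertex, as a loop of weight 0,
    -- is a sufficient base: on two vertices the only edge is traversed twice, in agreement with the
    -- factor 2.
    lightCycle : ∀ x xs → ∃₂ λ y ys → y ∷ ys ↭ x ∷ xs × length xs * path y ys y ≤ 2 * pairs (x ∷ xs)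
    lightCycle x [] = x , [] , ↭-refl , z≤n
    lightCycle v (x ∷ xs) with lightCycle x xs
    ... | y , ys , ys↭ , le with insertVertex v y ys y
    ...   | zs , zs↭ , le′ =
      y , zs , ↭-trans (↭-trans (prep y zs↭) (swap y v ↭-refl)) (prep v ys↭)
      , ≤-by 0
          (+-mono-≤ le (subst₂
            (λ l s → suc l * path y zs y + path y ys y ≤ suc l * path y ys y + s)
            (suc-injective (Perm.↭-length ys↭)) star le′))
          (eq (length xs) (path y zs y) (path y ys y) (∑ (x ∷ xs) (w v)) (pairs (x ∷ xs)))
      where
      star : w v y + 2 * ∑ ys (w v) + w v y ≡ 2 * ∑ (x ∷ xs) (w v)
      star = trans (eq′ (w v y) (∑ ys (w v))) (cong (2 *_) (∑-↭ ys↭ (w v)))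
        where
        eq′ : ∀ a b → a + 2 * b + a ≡ 2 * (a + b)
        eq′ = solve-∀
      eq : ∀ l T′ T s p → suc l * T′ + (2 * p + (suc l * T + 2 * s)) + 0 ≡
        2 * (s + p) + (l * T + (suc l * T′ + T))
      eq = solve-∀

    path≤pairs : ∀ a zs b → path a zs b ≤ pairs (a ∷ zs ∷ʳ b)
    path≤pairs a []       b = ≤-reflexive (sym (+-identityʳ _))
    path≤pairs a (z ∷ zs) b = +-mono-≤ (m≤m+n (w a z) _) (path≤pairs z zs b)

    -- The shape of the list enforces three vertices, so the edges of the cycle are distinct pairs;
    -- on two vertices one pair would be traversed twice.
    cycle≤pairs : ∀ y z m x → weight (cycle (y ∷ z ∷ m ∷ʳ x)) ≤ pairs (y ∷ z ∷ m ∷ʳ x)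
    cycle≤pairs y z m x = begin
      w y z + path z (m ++ x ∷ []) y
        ≡⟨ cong (λ es → w y z + weight es) (steps-++ z m x [] y) ⟩
      w y z + weight (steps z m x ++ [ (x , y) ])
        ≡⟨ cong (w y z +_) (∑-++ (steps z m x) [ (x , y) ] (uncurry w)) ⟩
      w y z + (path z m x + (w x y + 0))
        ≤⟨ +-monoʳ-≤ (w y z) (+-monoˡ-≤ (w x y + 0) (path≤pairs z m x)) ⟩
      w y z + (pairs (z ∷ m ∷ʳ x) + (w x y + 0))
        ≡⟨ cong (λ q → w y z + (pairs (z ∷ m ∷ʳ x) + (q + 0))) (w-sym x y) ⟩
      w y z + (pairs (z ∷ m ∷ʳ x) + (w y x + 0))
        ≤⟨ ≤-by (∑ m (w y)) (≤-reflexive (sym (∑-++ m [ x ] (w y))))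
             (eq (w y z) (pairs (z ∷ m ∷ʳ x)) (w y x) (∑ m (w y)) _) ⟩
      w y z + ∑ (m ∷ʳ x) (w y) + pairs (z ∷ m ∷ʳ x) ∎
      where
      open ≤-Reasoning
      eq : ∀ a b c d e → a + (b + (c + 0)) + e + d ≡ a + e + b + (d + (c + 0))
      eq = solve-∀

    -- Cycles with one heavy edge, and the configurations without a helpful exchange

    module _ (N : ℕ) where

      Light : V × V → Set
      Light e = uncurry w e < N

      GoodCycle : List V → Set
      GoodCycle vs = ∃₂ λ y ys → y ∷ ys ↭ vs × path y ys y + 3 ≤ 2 * N × All Light (cycle (y ∷ ys))

      -- A cycle, read as y , m , x, whose closing edge is heavy, and no exchange of
      -- that edge with another one helps.
      record Rigid (vs : List V) : Set where
        field
          y x    : V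
          m      : List V
          vs↭    : y ∷ x ∷ m ↭ vs
          wxy    : w x y ≡ N
          wx     : All (λ v → w x v ≡ 0 ⊎ w x v ≡ N) m
          wy     : All (λ v → w y v ≡ 0 ⊎ w y v ≡ N) m
          inner  : pairs m ≡ 0
          degree : ∑ m (λ v → w x v + w y v) + N ≡ N * length m

      -- The edge relation "weight N" is a star with centre x on all vertices but z.
      record Star (vs : List V) : Set where
        field
          z x   : V
          ks    : List V
          vs↭   : z ∷ ks ∷ʳ x ↭ vs
          wx    : All (λ v → w x v ≡ N) ks
          wxz   : w x z ≡ 0
          inner : pairs (z ∷ ks) ≡ 0

      record Triangle (vs : List V) : Set where
        field
          z p r x y : V
          vs↭ : z ∷ p ∷ r ∷ x ∷ y ∷ [] ↭ vs
          N≡5 : N ≡ 5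
          wxy : w x y ≡ N
          wxr : w x r ≡ N
          wyr : w y r ≡ N
          wxz : w x z ≡ 0
          wyz : w y z ≡ 0
          wxp : w x p ≡ 0
          wyp : w y p ≡ 0
          wzp : w z p ≡ 0
          wzr : w z r ≡ 0
          wpr : w p r ≡ 0

      heavyClosing : ∀ a z zs → Any (λ e → N ≤ uncurry w e) (cycle (a ∷ z ∷ zs)) →
        ∃ λ y → ∃₂ λ m x → y ∷ m ∷ʳ x ↭ a ∷ z ∷ zs × N ≤ w x y ×
          weight (cycle (y ∷ m ∷ʳ x)) ≡ weight (cycle (a ∷ z ∷ zs))
      heavyClosing a z zs heavy with split a (z ∷ zs) a heavy
      ... | cutAt us vs u v bs as p zs≡ steps≡ left right =
        go vs (map proj₁ bs) (map proj₂ as) zs≡ lastOf (trans (sym (map-proj₂-steps a vs a)) (cong (map proj₂) (right a)))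
        where
        lastOf : a ∷ us ≡ map proj₁ bs ∷ʳ u
        lastOf = trans (sym (map-proj₁-steps a us a))
          (trans (cong (map proj₁) (left a)) (List.map-++ proj₁ bs [ (u , a) ]))
        go : ∀ {us} vs is ts → z ∷ zs ≡ us ++ vs → a ∷ us ≡ is ∷ʳ u → vs ∷ʳ a ≡ v ∷ ts →
          ∃ λ y → ∃₂ λ m x → y ∷ m ∷ʳ x ↭ a ∷ z ∷ zs × N ≤ w x y ×
            weight (cycle (y ∷ m ∷ʳ x)) ≡ weight (cycle (a ∷ z ∷ zs))
        -- With nothing after the cut the heavy edge closes the cycle already; otherwise the cycle
        -- is rotated to begin at v.
        go []        []       _ zs≡ refl _ with () ← zs≡
        go []        (i ∷ is) _ zs≡ refl refl =
          a , is , u , ↭-reflexive L≡ , p , cong (λ L → weight (cycle L)) L≡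
          where
          L≡ : a ∷ is ∷ʳ u ≡ a ∷ z ∷ zs
          L≡ = cong (a ∷_) (sym (trans zs≡ (List.++-identityʳ (is ∷ʳ u))))
        go {us} (v′ ∷ vs) is _ zs≡ a∷us≡ refl =
          v , vs ++ is , u
          , ↭-trans (↭-reflexive L≡) (↭-trans (Perm.++-comm (v ∷ vs) (a ∷ us)) (↭-reflexive R≡))
          , p
          , trans (cong (λ L → weight (cycle L)) L≡)
              (trans (∑-↭ (cycle-rotate (v ∷ vs) (a ∷ us)) (uncurry w))
                (cong (λ L → weight (cycle L)) R≡))
          where
          L≡ : v ∷ (vs ++ is) ∷ʳ u ≡ v ∷ vs ++ a ∷ us
          L≡ = cong (v ∷_) (trans (List.++-assoc vs is [ u ]) (cong (vs ++_) (sym a∷us≡)))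
          R≡ : a ∷ us ++ v ∷ vs ≡ a ∷ z ∷ zs
          R≡ = cong (a ∷_) (sym zs≡)

      module _ (y : V) (m : List V) (x : V) (N≡ : N ≡ 2 + length m) (wxy : w x y ≡ N)
        (light : path y m x + 3 ≤ N) (few : pairs (y ∷ x ∷ m) ≤ N * length m)
        where

        private
          -- Along y ... u v ... x the edges xy and uv give way to xu and yv. Since xy weighs N, the
          -- last condition keeps the total at most 2N - 3, and the other two prevent a new heavy
          -- edge.
          Exchange : V × V → Set
          Exchange (u , v) = w x u < N × w y v < N × w x u + w y v ≤ N

          -- If the sum is exactly N, the exchange can have failed only because one of the two edges
          -- weighs N by itself; the other one then weighs 0.
          Stuck : V × V → Set
          Stuck (u , v) = N ≤ w x u + w y v ×
            (w x u + w y v ≡ N → (w x u ≡ 0 ⊎ w x u ≡ N) × (w y v ≡ 0 ⊎ w y v ≡ N))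

          exchange? : ∀ e → Stuck e ⊎ Exchange e
          exchange? (u , v) with <-≤-connex (w x u) N | <-≤-connex (w y v) N
          ... | inj₂ N≤ | _ = inj₁ (≤-trans N≤ (m≤m+n _ _) , λ eq →
            let wxu = ≤-antisym (≤-trans (m≤m+n (w x u) _) (≤-reflexive eq)) N≤
            in inj₂ wxu , inj₁ (+-cancelˡ-≡ N _ _ (trans (cong (_+ w y v) (sym wxu)) (trans eq (sym (+-identityʳ N))))))
          ... | inj₁ _ | inj₂ N≤ = inj₁ (≤-trans N≤ (m≤n+m _ _) , λ eq →
            let wyv = ≤-antisym (≤-trans (m≤n+m (w y v) _) (≤-reflexive eq)) N≤
            in inj₁ (+-cancelʳ-≡ N _ _ (trans (cong (w x u +_) (sym wyv)) eq)) , inj₂ wyv)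
          ... | inj₁ <₁ | inj₁ <₂ with ≤-<-connex (w x u + w y v) N
          ...   | inj₁ le = inj₂ (<₁ , <₂ , le)
          ...   | inj₂ gt = inj₁ (<⇒≤ gt , λ eq → contradiction (sym eq) (<⇒≢ gt))

          lightSteps : All Light (steps y m x)
          lightSteps = All.map (λ le → ≤-trans (s≤s le) (≤-trans (≤-by 2 ≤-refl (eq (path y m x))) light))
            (≤∑ (steps y m x) (uncurry w))
            where
            eq : ∀ a → suc a + a + 2 ≡ a + 3 + a
            eq = solve-∀

          exchange : SplitAt Exchange y m x → GoodCycle (y ∷ x ∷ m)
          exchange (cutAt us vs u v bs as (xu , yv , le) m≡ steps≡ left right)
            with All.++⁻ bs (subst (All Light) steps≡ lightSteps)
          ... | lightBs , _ ∷ lightAs =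
            -- The new tour is y ... u x ... v y, with the part from v to x traversed backwards.
            y , us ++ x ∷ reverse vs
            , prep y (↭-trans (Perm.shift x us (reverse vs))
                (prep x (↭-trans (Perm.++⁺ˡ us (Perm.↭-reverse vs)) (↭-reflexive (sym m≡)))))
            , bound
            , Perm.All-resp-↭ (↭-sym steps↭)
                (All.++⁺ (All.++⁺ lightBs (subst (_< N) (w-sym x u) xu ∷ []))
                  (All.map⁺ (All.map (λ {e} → subst (_< N) (w-sym (proj₁ e) (proj₂ e))) (yv ∷ lightAs))))
            where
            steps↭ : steps y (us ++ x ∷ reverse vs) y ↭
              (bs ∷ʳ (u , x)) ++ map Product.swap ((y , v) ∷ as)
            steps↭ = ↭-trans (↭-reflexive (trans (steps-++ y us x (reverse vs) y) (cong (_++ _) (left x))))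
              (Perm.++⁺ˡ (bs ∷ʳ (u , x)) (↭-trans (steps-reverse y vs x)
                (↭-reflexive (cong (map Product.swap) (right y)))))
            weight≡ : path y (us ++ x ∷ reverse vs) y ≡ (weight bs + (w x u + 0)) + (w y v + weight as)
            weight≡ = trans (∑-↭ steps↭ (uncurry w)) (trans
              (∑-++ (bs ∷ʳ (u , x)) (map Product.swap ((y , v) ∷ as)) (uncurry w))
              (cong₂ _+_
                (trans (∑-++ bs [ (u , x) ] (uncurry w)) (cong (λ q → weight bs + (q + 0)) (w-sym u x)))
                (weight-swap ((y , v) ∷ as))))
            bound : path y (us ++ x ∷ reverse vs) y + 3 ≤ 2 * N
            bound = subst (λ q → q + 3 ≤ 2 * N) (sym weight≡)
              (≤-by (w u v) (+-mono-≤ le (subst (λ q → q + 3 ≤ N)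
                  (trans (cong weight steps≡) (∑-++ bs ((u , v) ∷ as) (uncurry w))) light))
                (eq (weight bs) (weight as) (w x u) (w y v) (w u v) N))
              where
              eq : ∀ b a p q r N → b + (p + 0) + (q + a) + 3 + (N + N) + r ≡
                2 * N + (p + q + (b + (r + a) + 3))
              eq = solve-∀

          -- Over the whole path the sums w x u + w y v add up to 2N + S, because xy is counted at
          -- both ends. Being stuck makes this at least N(l + 1) for l = length m, while `few` says
          -- N + S + pairs m ≤ N l. Hence equality holds throughout and pairs m = 0.
          module Tight (stuck : All Stuck (steps y m x)) where

            S = ∑ m (w x) + ∑ m (w y)

            sum≡ : ∑ (steps y m x) (λ e → w x (proj₁ e) + w y (proj₂ e)) ≡ N + N + S
            sum≡ = begin
              ∑ (steps y m x) (λ e → w x (proj₁ e) + w y (proj₂ e))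
                ≡⟨ ∑-+ (steps y m x) (λ e → w x (proj₁ e)) (λ e → w y (proj₂ e)) ⟩
              ∑ (steps y m x) (λ e → w x (proj₁ e)) + ∑ (steps y m x) (λ e → w y (proj₂ e))
                ≡⟨ cong₂ _+_ (∑-map (steps y m x) proj₁ (w x)) (∑-map (steps y m x) proj₂ (w y)) ⟨
              ∑ (map proj₁ (steps y m x)) (w x) + ∑ (map proj₂ (steps y m x)) (w y)
                ≡⟨ cong₂ (λ as bs → ∑ as (w x) + ∑ bs (w y)) (map-proj₁-steps y m x) (map-proj₂-steps y m x) ⟩
              w x y + ∑ m (w x) + ∑ (m ∷ʳ x) (w y)
                ≡⟨ cong (w x y + ∑ m (w x) +_) (∑-++ m [ x ] (w y)) ⟩
              w x y + ∑ m (w x) + (∑ m (w y) + (w y x + 0))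
                ≡⟨ cong₂ (λ a b → a + ∑ m (w x) + (∑ m (w y) + (b + 0))) wxy (trans (w-sym y x) wxy) ⟩
              N + ∑ m (w x) + (∑ m (w y) + (N + 0))
                ≡⟨ eq N (∑ m (w x)) (∑ m (w y)) ⟩
              N + N + S ∎
              where
              open ≡-Reasoning
              eq : ∀ N a b → N + a + (b + (N + 0)) ≡ N + N + (a + b)
              eq = solve-∀

            pairs≡ : pairs (y ∷ x ∷ m) ≡ N + S + pairs m
            pairs≡ = trans (cong (λ q → q + ∑ m (w y) + (∑ m (w x) + pairs m)) (trans (w-sym y x) wxy))
              (eq N (∑ m (w x)) (∑ m (w y)) (pairs m))
              where
              eq : ∀ N a b p → N + b + (a + p) ≡ N + (a + b) + p
              eq = solve-∀

            few′ : N + S + pairs m ≤ N * length m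
            few′ = subst (_≤ N * length m) pairs≡ few

            all≡ : All (λ e → w x (proj₁ e) + w y (proj₂ e) ≡ N) (steps y m x)
            all≡ = ∑-tight N (steps y m x) (All.map proj₁ stuck)
              (subst₂ (λ s l → s ≤ N * l) (sym sum≡) (sym (length-steps y m x))
                (≤-by (pairs m) few′ (eq N S (pairs m) (length m))))
              where
              eq : ∀ N S p l → N + N + S + N * l + p ≡ N * suc l + (N + S + p)
              eq = solve-∀

            sumIs : N + S ≡ N * length m
            sumIs = +-cancelˡ-≡ N _ _ (begin
              N + (N + S)
                ≡⟨ +-assoc N N S ⟨
              N + N + S
                ≡⟨ sum≡ ⟨
              ∑ (steps y m x) (λ e → w x (proj₁ e) + w y (proj₂ e))
                ≡⟨ ∑-all≡ (steps y m x) all≡ ⟩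
              length (steps y m x) * N
                ≡⟨ cong (_* N) (length-steps y m x) ⟩
              N + length m * N
                ≡⟨ cong (N +_) (*-comm (length m) N) ⟩
              N + N * length m ∎)
              where
              open ≡-Reasoning
              ∑-all≡ : ∀ (es : List (V × V)) {f} → All (λ e → f e ≡ N) es → ∑ es f ≡ length es * N
              ∑-all≡ []       []       = refl
              ∑-all≡ (e ∷ es) (p ∷ ps) = cong₂ _+_ p (∑-all≡ es ps)

            values : All (λ e → (w x (proj₁ e) ≡ 0 ⊎ w x (proj₁ e) ≡ N) × (w y (proj₂ e) ≡ 0 ⊎ w y (proj₂ e) ≡ N))
              (steps y m x)
            values = All.zipWith (λ (s , eq) → proj₂ s eq) (stuck , all≡)

            rigid : Rigid (y ∷ x ∷ m)
            rigid = record
              { y = y ; x = x ; m = m ; vs↭ = ↭-refl ; wxy = wxy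
              ; wx = All.tail (subst (All _) (map-proj₁-steps y m x) (All.map⁺ (All.map proj₁ values)))
              ; wy = proj₁ (All.∷ʳ⁻ (subst (All _) (map-proj₂-steps y m x) (All.map⁺ (All.map proj₂ values))))
              ; inner = n≤0⇒n≡0 (+-cancelˡ-≤ (N + S) _ _ (≤-trans few′
                  (≤-reflexive (trans (sym sumIs) (sym (+-identityʳ _))))))
              ; degree = trans (cong (_+ N) (∑-+ m (w x) (w y))) (trans (+-comm S N) sumIs)
              }

        twoOpt : GoodCycle (y ∷ x ∷ m) ⊎ Rigid (y ∷ x ∷ m)
        twoOpt with All.decide exchange? (steps y m x)
        ... | inj₂ found = inj₁ (exchange (split y m x found))
        ... | inj₁ stuck = inj₂ (Tight.rigid stuck)

      private
        nonzero : ∀ {a} → a ≡ 0 ⊎ a ≡ N → 1 ≤ a → a ≡ N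
        nonzero (inj₂ eq) _ = eq
        nonzero (inj₁ refl) ()

        allHeavy : ∀ (ks : List V) (f : V → ℕ) → All (λ v → f v ≡ 0 ⊎ f v ≡ N) ks → All (λ v → 1 ≤ f v) ks →
          All (λ v → f v ≡ N) ks
        allHeavy ks f vals pos = All.zipWith (λ (a , b) → nonzero a b) (vals , pos)

        ∑-heavy : ∀ (ks : List V) {f : V → ℕ} → All (λ v → f v ≡ N) ks → ∑ ks f ≡ N * length ks
        ∑-heavy []       []       = sym (*-zeroʳ N)
        ∑-heavy (k ∷ ks) (p ∷ ps) = trans (cong₂ _+_ p (∑-heavy ks ps)) (sym (*-suc N (length ks)))

        star : ∀ {vs y x z m} → y ∷ x ∷ z ∷ m ↭ vs → w x y ≡ N → All (λ v → w x v ≡ N) m →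
          w x z ≡ 0 → w y z ≡ 0 → ∑ m (w y) ≡ 0 → pairs (z ∷ m) ≡ 0 → Star vs
        star {vs} {y} {x} {z} {m} vs↭ wxy heavy wxz wyz wym inner = record
          { z = z ; x = x ; ks = y ∷ m
          ; vs↭ = ↭-trans (prep z (prep y (↭-sym (Perm.∷↭∷ʳ x m))))
              (↭-trans (swap z y ↭-refl) (↭-trans (prep y (swap z x ↭-refl)) vs↭))
          ; wx = wxy ∷ heavy
          ; wxz = wxz
          ; inner = trans (pairs-↭ (swap {xs = m} z y ↭-refl))
              (cong₂ _+_ (cong₂ _+_ wyz wym) inner)
          }

        -- The tour z, y, q, m, p, x meets x and y only along edges of weight 0, and there is no
        -- weight at all among the other vertices.
        lightTour : ∀ {vs y x z q p m} → y ∷ x ∷ z ∷ q ∷ p ∷ m ↭ vs → 2 ≤ N →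
          w x z ≡ 0 → w y z ≡ 0 → w y q ≡ 0 → w x p ≡ 0 → pairs (z ∷ q ∷ p ∷ m) ≡ 0 → GoodCycle vs
        lightTour {vs} {y} {x} {z} {q} {p} {m} vs↭ 2≤N wxz wyz wyq wxp inner =
          z , y ∷ q ∷ m ++ p ∷ x ∷ []
          , ↭-trans order vs↭
          , subst (λ l → l + 3 ≤ 2 * N) (sym weight≡0) (≤-trans (s≤s (s≤s (s≤s z≤n))) (*-monoʳ-≤ 2 2≤N))
          , All.map (λ le → ≤-trans (s≤s le) (subst (_< N) (sym weight≡0) (≤-trans (s≤s z≤n) 2≤N)))
              (≤∑ (cycle (z ∷ y ∷ q ∷ m ++ p ∷ x ∷ [])) (uncurry w))
          where
          order : z ∷ y ∷ q ∷ m ++ p ∷ x ∷ [] ↭ y ∷ x ∷ z ∷ q ∷ p ∷ m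
          order = ↭-trans (prep z (prep y (prep q (Perm.++-comm m (p ∷ x ∷ [])))))
            (↭-trans (swap z y ↭-refl) (prep y
              (↭-trans (prep z (↭-trans (prep q (swap p x ↭-refl)) (swap q x ↭-refl))) (swap z x ↭-refl))))
          inside : path q m p ≡ 0
          inside = n≤0⇒n≡0 (begin
            path q m p           ≤⟨ path≤pairs q m p ⟩
            pairs (q ∷ m ∷ʳ p)   ≡⟨ pairs-↭ (prep q (↭-sym (Perm.∷↭∷ʳ p m))) ⟩
            pairs (q ∷ p ∷ m)    ≤⟨ m≤n+m _ (∑ (q ∷ p ∷ m) (w z)) ⟩
            pairs (z ∷ q ∷ p ∷ m) ≡⟨ inner ⟩
            0                    ∎)
            where open ≤-Reasoning
          weight≡0 : path z (y ∷ q ∷ m ++ p ∷ x ∷ []) z ≡ 0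
          weight≡0 = cong₂ _+_ (trans (w-sym z y) wyz) (cong₂ _+_ wyq (begin
            path q (m ++ p ∷ x ∷ []) z
              ≡⟨ cong weight (steps-++ q m p (x ∷ []) z) ⟩
            weight (steps q m p ++ (p , x) ∷ (x , z) ∷ [])
              ≡⟨ ∑-++ (steps q m p) _ (uncurry w) ⟩
            path q m p + (w p x + (w x z + 0))
              ≡⟨ cong₂ _+_ inside (cong₂ _+_ (trans (w-sym p x) wxp) (cong (_+ 0) wxz)) ⟩
            0 ∎))
            where open ≡-Reasoning

      -- The heavy edges from x and y to m number length m - 1, so some z is free of them, and the
      -- other vertices of m carry one each on average. If x avoids some p and y avoids another
      -- vertex q, `lightTour` applies. Otherwise one of x and y is heavy to all these vertices,
      -- which gives a star, or both are heavy to all but a common p. In the last case, with l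
      -- vertices besides p, 2l = l + 1 leaves a single vertex r and the triangle x, y, r.
      rigidCases : ∀ {vs} → N ≡ length vs → Rigid vs → GoodCycle vs ⊎ Star vs ⊎ Triangle vs
      rigidCases {vs} N≡ record { y = y ; x = x ; m = m ; vs↭ = vs↭ ; wxy = wxy ; wx = wx ; wy = wy
                                ; inner = inner ; degree = degree }
        with extract (λ v → zero? (w x v + w y v)) m
      ... | inj₂ pos = contradiction
              (≤-by 0 (+-mono-≤ (≤-reflexive degree) low)
                (eq (∑ m (λ v → w x v + w y v)) N (N * length m)))
              (<⇒≱ 0<N)
        where
        N≡₂ : N ≡ 2 + length m
        N≡₂ = trans N≡ (sym (Perm.↭-length vs↭))
        0<N : 0 < N
        0<N = subst (0 <_) (sym N≡₂) (s≤s z≤n)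
        eq : ∀ s n p → n + (p + s) + 0 ≡ 0 + (s + n + p)
        eq = solve-∀
        heavy : ∀ {a b} → a ≡ 0 ⊎ a ≡ N → b ≡ 0 ⊎ b ≡ N → 1 ≤ a + b → N ≤ a + b
        heavy (inj₂ refl) _ _ = m≤m+n _ _
        heavy (inj₁ refl) (inj₂ refl) _ = ≤-refl
        heavy (inj₁ refl) (inj₁ refl) ()
        low : N * length m ≤ ∑ m (λ v → w x v + w y v)
        low = subst (_≤ ∑ m (λ v → w x v + w y v)) (trans (∑-const m N) (*-comm (length m) N))
          (∑-mono m (All.zipWith (λ ((a , b) , c) → heavy a b c) (All.zip (wx , wy) , pos)))
      ... | inj₁ (z , m₁ , wz , m↭)
        with m+n≡0⇒m≡0 (w x z) wz | m+n≡0⇒n≡0 (w x z) wz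
           | Perm.All-resp-↭ m↭ wx | Perm.All-resp-↭ m↭ wy | trans (sym (pairs-↭ m↭)) inner
      ... | wxz | wyz | _ ∷ wx₁ | _ ∷ wy₁ | inner₁ = step
        where
        N≡₁ : N ≡ 3 + length m₁
        N≡₁ = trans N≡ (trans (sym (Perm.↭-length vs↭)) (cong (2 +_) (Perm.↭-length m↭)))
        2≤N : 2 ≤ N
        2≤N = subst (2 ≤_) (sym N≡₁) (s≤s (s≤s z≤n))
        vs↭₁ : y ∷ x ∷ z ∷ m₁ ↭ vs
        vs↭₁ = ↭-trans (prep y (prep x (↭-sym m↭))) vs↭
        xy↭ : ∀ {ks} → y ∷ x ∷ ks ↭ vs → x ∷ y ∷ ks ↭ vs
        xy↭ = ↭-trans (swap x y ↭-refl)
        sum₁ : ∑ m₁ (w x) + ∑ m₁ (w y) ≡ N * length m₁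
        sum₁ = +-cancelʳ-≡ N _ _ (begin
          ∑ m₁ (w x) + ∑ m₁ (w y) + N            ≡⟨ cong (_+ N) (∑-+ m₁ (w x) (w y)) ⟨
          ∑ m₁ (λ v → w x v + w y v) + N         ≡⟨ cong (λ q → q + ∑ m₁ (λ v → w x v + w y v) + N) wz ⟨
          ∑ (z ∷ m₁) (λ v → w x v + w y v) + N   ≡⟨ cong (_+ N) (∑-↭ m↭ _) ⟨
          ∑ m (λ v → w x v + w y v) + N          ≡⟨ degree ⟩
          N * length m                           ≡⟨ cong (N *_) (Perm.↭-length m↭) ⟩
          N * suc (length m₁)                    ≡⟨ *-suc N (length m₁) ⟩
          N + N * length m₁                      ≡⟨ +-comm N _ ⟩
          N * length m₁ + N                      ∎)
          where open ≡-Reasoning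
        starX : All (λ v → w x v ≡ N) m₁ → Star vs
        starX heavy = star vs↭₁ wxy heavy wxz wyz
          (+-cancelˡ-≡ (N * length m₁) _ _ (trans (cong (_+ ∑ m₁ (w y)) (sym (∑-heavy m₁ heavy)))
            (trans sum₁ (sym (+-identityʳ _))))) inner₁
        starY : All (λ v → w y v ≡ N) m₁ → Star vs
        starY heavy = star (xy↭ vs↭₁) (trans (w-sym y x) wxy) heavy wyz wxz
          (+-cancelʳ-≡ (N * length m₁) _ _ (trans (cong (∑ m₁ (w x) +_) (sym (∑-heavy m₁ heavy))) sum₁)) inner₁
        step : GoodCycle vs ⊎ Star vs ⊎ Triangle vs
        step with extract (λ v → zero? (w x v)) m₁
        ... | inj₂ pos = inj₂ (inj₁ (starX (allHeavy m₁ (w x) wx₁ pos)))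
        ... | inj₁ (p , m₂ , wxp , m₁↭)
          with Perm.All-resp-↭ m₁↭ wx₁ | Perm.All-resp-↭ m₁↭ wy₁
        ...   | _ ∷ wx₂ | wyp ∷ wy₂ with extract (λ v → zero? (w y v)) m₂
        ...     | inj₁ (q , m₃ , wyq , m₂↭) =
          inj₁ (lightTour {z = z} {q} {p} {m₃} (↭-trans (prep y (prep x (prep z (↭-sym m₁↭′)))) vs↭₁) 2≤N
                 wxz wyz wyq wxp (trans (sym (pairs-↭ (prep z m₁↭′))) inner₁))
          where
          m₁↭′ : m₁ ↭ q ∷ p ∷ m₃
          m₁↭′ = ↭-trans m₁↭ (↭-trans (prep p m₂↭) (swap p q ↭-refl))
        ...     | inj₂ pos with allHeavy m₂ (w y) wy₂ pos | wyp
        ...       | heavyY | inj₂ wypN = inj₂ (inj₁ (starY (Perm.All-resp-↭ (↭-sym m₁↭) (wypN ∷ heavyY))))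
        ...       | heavyY | inj₁ wyp0 with extract (λ v → zero? (w x v)) m₂
        ...         | inj₁ (p′ , m₃ , wxp′ , m₂↭) =
          inj₁ (lightTour {z = z} {p} {p′} {m₃} (↭-trans (prep y (prep x (prep z (↭-sym m₁↭′)))) vs↭₁) 2≤N
                 wxz wyz wyp0 wxp′ (trans (sym (pairs-↭ (prep z m₁↭′))) inner₁))
          where
          m₁↭′ : m₁ ↭ p ∷ p′ ∷ m₃
          m₁↭′ = ↭-trans m₁↭ (prep p m₂↭)
        ...         | inj₂ pos′ = inj₂ (inj₂ (triangle m₂ m₁↭ (allHeavy m₂ (w x) wx₂ pos′) heavyY one))
          where
          l = length m₂
          one : length m₂ ≡ 1
          one = +-cancelʳ-≡ l _ _ (*-cancelˡ-≡ _ _ N {{>-nonZero (≤-trans (s≤s z≤n) 2≤N)}} (begin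
            N * (l + l)
              ≡⟨ *-distribˡ-+ N l l ⟩
            N * l + N * l
              ≡⟨ cong₂ _+_ (∑-heavy m₂ (allHeavy m₂ (w x) wx₂ pos′)) (∑-heavy m₂ heavyY) ⟨
            ∑ m₂ (w x) + ∑ m₂ (w y)
              ≡⟨ cong₂ (λ a b → a + ∑ m₂ (w x) + (b + ∑ m₂ (w y))) wxp wyp0 ⟨
            ∑ (p ∷ m₂) (w x) + ∑ (p ∷ m₂) (w y)
              ≡⟨ cong₂ _+_ (∑-↭ m₁↭ (w x)) (∑-↭ m₁↭ (w y)) ⟨
            ∑ m₁ (w x) + ∑ m₁ (w y)
              ≡⟨ sum₁ ⟩
            N * length m₁
              ≡⟨ cong (N *_) (Perm.↭-length m₁↭) ⟩
            N * (1 + l) ∎))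
            where open ≡-Reasoning
          triangle : ∀ m₂ → m₁ ↭ p ∷ m₂ → All (λ v → w x v ≡ N) m₂ → All (λ v → w y v ≡ N) m₂ →
            length m₂ ≡ 1 → Triangle vs
          triangle (r ∷ []) m₁↭ (wxr ∷ []) (wyr ∷ []) _ = record
            { z = z ; p = p ; r = r ; x = x ; y = y
            ; vs↭ = ↭-trans (↭-trans (Perm.++-comm (z ∷ p ∷ r ∷ []) (x ∷ y ∷ [])) (swap x y ↭-refl))
                (↭-trans (prep y (prep x (prep z (↭-sym m₁↭)))) vs↭₁)
            ; N≡5 = trans N≡₁ (cong (3 +_) (Perm.↭-length m₁↭))
            ; wxy = wxy ; wxr = wxr ; wyr = wyr ; wxz = wxz ; wyz = wyz ; wxp = wxp ; wyp = wyp0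
            ; wzp = m+n≡0⇒m≡0 (w z p) wz·
            ; wzr = m+n≡0⇒m≡0 (w z r) (m+n≡0⇒n≡0 (w z p) wz·)
            ; wpr = m+n≡0⇒m≡0 (w p r) (m+n≡0⇒m≡0 (w p r + 0) (m+n≡0⇒n≡0 (w z p + (w z r + 0)) all0))
            }
            where
            all0 : pairs (z ∷ p ∷ r ∷ []) ≡ 0
            all0 = trans (sym (pairs-↭ (prep z m₁↭))) inner₁
            wz· : w z p + (w z r + 0) ≡ 0
            wz· = m+n≡0⇒m≡0 (w z p + (w z r + 0)) all0

-- Adjacency and nonadjacency counts

equality : ∀ {n} → Fin n → Fin n → ℕ
equality u v = if does (u Fin.≟ v) then 1 else 0

-- The adjacency matrix of the complement. Its diagonal is 0, so the value 0 means an edge only for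
-- distinct vertices.
nonadjacency : ∀ {n} → Graph (Fin n) → Fin n → Fin n → ℕ
nonadjacency G u v = if does (u Fin.≟ v) then 0 else if adj G u v then 0 else 1

∑-suc : ∀ {n} (f : Fin (suc n) → ℕ) → ∑ (allFin (suc n)) f ≡ f zero + ∑ (allFin n) (f ∘ suc)
∑-suc f = cong (λ xs → f zero + sum xs)
  (trans (List.map-tabulate suc f) (sym (List.map-tabulate id (f ∘ suc))))

∑-equality : ∀ {n} (f : Fin n → ℕ) j → ∑ (allFin n) (λ i → f i * equality i j) ≡ f j
∑-equality {suc n} f zero = begin
  ∑ (allFin (suc n)) (λ i → f i * equality i zero)
    ≡⟨ ∑-suc (λ i → f i * equality i zero) ⟩
  f zero * 1 + ∑ (allFin n) (λ i → f (suc i) * 0)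
    ≡⟨ cong₂ _+_ (*-identityʳ (f zero))
         (∑≡0 (allFin n) (All.universal (λ i → *-zeroʳ (f (suc i))) (allFin n))) ⟩
  f zero + 0
    ≡⟨ +-identityʳ (f zero) ⟩
  f zero ∎
  where open ≡-Reasoning
∑-equality {suc n} f (suc j) = begin
  ∑ (allFin (suc n)) (λ i → f i * equality i (suc j))             ≡⟨ ∑-suc (λ i → f i * equality i (suc j)) ⟩
  f zero * 0 + ∑ (allFin n) (λ i → f (suc i) * equality i j)      ≡⟨ cong₂ _+_ (*-zeroʳ (f zero)) (∑-equality (f ∘ suc) j) ⟩
  f (suc j)                                                       ∎
  where open ≡-Reasoning

∑-allFin : ∀ n c → ∑ (allFin n) (λ _ → c) ≡ n * c
∑-allFin n c = trans (∑-const (allFin n) c) (cong (_* c) (List.length-tabulate {n = n} id))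

module _ {n} (G : Graph (Fin n)) where

  private
    a = adjacency G
    h = nonadjacency G

  -- Entrywise form of A + H + I = J.
  partition : ∀ u v → a u v + h u v + equality u v ≡ 1
  partition u v with u Fin.≟ v
  ... | yes refl rewrite Graph.irrefl G u = refl
  ... | no _ with adj G u v
  ...   | true  = refl
  ...   | false = refl

  adjacency-sym : ∀ u v → a u v ≡ a v u
  adjacency-sym u v = cong (if_then 1 else 0) (Graph.sym G u v)

  nonadjacency-sym : ∀ u v → h u v ≡ h v u
  nonadjacency-sym u v with u Fin.≟ v | v Fin.≟ u
  ... | yes _   | yes _   = refl
  ... | no _    | no _    = cong (if_then 0 else 1) (Graph.sym G u v)
  ... | yes u≡v | no v≢u  = contradiction (sym u≡v) v≢u
  ... | no u≢v  | yes v≡u = contradiction (sym v≡u) u≢v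

  nonadjacency-irrefl : ∀ v → h v v ≡ 0
  nonadjacency-irrefl v rewrite dec-true (v Fin.≟ v) refl = refl

  nonadjacency≤1 : ∀ u v → h u v ≤ 1
  nonadjacency≤1 u v = ≤-trans (m≤n+m (h u v) (a u v))
    (≤-trans (m≤m+n (a u v + h u v) (equality u v)) (≤-reflexive (partition u v)))

  nonadjacency≡0⇒Edge : ∀ {u v} → u ≢ v → h u v ≡ 0 → Edge G u v
  nonadjacency≡0⇒Edge {u} {v} u≢v eq with u Fin.≟ v
  ... | yes u≡v = contradiction u≡v u≢v
  ... | no _ with adj G u v
  ...   | true  = refl
  ...   | false with () ← eq

  nonadjacency≡1⇒¬adj : ∀ {u v} → h u v ≡ 1 → adj G u v ≡ false
  nonadjacency≡1⇒¬adj {u} {v} eq with u Fin.≟ v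
  ... | yes _ with () ← eq
  nonadjacency≡1⇒¬adj {u} {v} eq | no _ with adj G u v
  ...   | false = refl
  ...   | true with () ← eq

  degree : Fin n → ℕ
  degree i = ∑ (allFin n) (a i)

  codegree : Fin n → ℕ
  codegree i = ∑ (allFin n) (h i)

  ∑-partition : ∀ (w : Fin n → ℕ) j →
    ∑ (allFin n) (λ i → w i * a i j) + ∑ (allFin n) (λ i → w i * h i j) + w j ≡ ∑ (allFin n) w
  ∑-partition w j = begin
    ∑ (allFin n) (λ i → w i * a i j) + ∑ (allFin n) (λ i → w i * h i j) + w j
      ≡⟨ cong₂ _+_ (∑-+ (allFin n) (λ i → w i * a i j) (λ i → w i * h i j)) (∑-equality w j) ⟨
    ∑ (allFin n) (λ i → w i * a i j + w i * h i j) + ∑ (allFin n) (λ i → w i * equality i j)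
      ≡⟨ ∑-+ (allFin n) (λ i → w i * a i j + w i * h i j) (λ i → w i * equality i j) ⟨
    ∑ (allFin n) (λ i → w i * a i j + w i * h i j + w i * equality i j)
      ≡⟨ ∑-cong (allFin n) (λ i → trans (distrib (w i) (a i j) (h i j) (equality i j))
           (trans (cong (w i *_) (partition i j)) (*-identityʳ (w i)))) ⟩
    ∑ (allFin n) w ∎
    where
    open ≡-Reasoning
    distrib : ∀ w x y z → w * x + w * y + w * z ≡ w * (x + y + z)
    distrib = solve-∀

  degree+codegree : ∀ j → degree j + codegree j + 1 ≡ n
  degree+codegree j = trans (cong₂ (λ x y → x + y + 1)
      (∑-cong (allFin n) (λ i → trans (adjacency-sym j i) (sym (*-identityˡ (a i j)))))
      (∑-cong (allFin n) (λ i → trans (nonadjacency-sym j i) (sym (*-identityˡ (h i j))))))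
    (trans (∑-partition (λ _ → 1) j) (trans (∑-allFin n 1) (*-identityʳ n)))

  totalDegree : ∑ (allFin n) degree + ∑ (allFin n) codegree + n * 1 ≡ n * n
  totalDegree = begin
    ∑ (allFin n) degree + ∑ (allFin n) codegree + n * 1
      ≡⟨ cong₂ _+_ (∑-+ (allFin n) degree codegree) (∑-allFin n 1) ⟨
    ∑ (allFin n) (λ i → degree i + codegree i) + ∑ (allFin n) (λ _ → 1)
      ≡⟨ ∑-+ (allFin n) (λ i → degree i + codegree i) (λ _ → 1) ⟨
    ∑ (allFin n) (λ i → degree i + codegree i + 1)
      ≡⟨ ∑-cong (allFin n) degree+codegree ⟩
    ∑ (allFin n) (λ _ → n)
      ≡⟨ ∑-allFin n n ⟩
    n * n ∎
    where open ≡-Reasoning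

  codegree-column : ∀ j → codegree j ≡ ∑ (allFin n) (λ i → h i j)
  codegree-column j = ∑-cong (allFin n) (nonadjacency-sym j)

  isolated⇒nonadjacent : ∀ {v} j → degree v ≡ 0 → v ≢ j → h v j ≡ 1
  isolated⇒nonadjacent {v} j isolated v≢j = begin
    h v j
      ≡⟨ +-identityʳ (h v j) ⟨
    0 + h v j + 0
      ≡⟨ cong₂ (λ x y → x + h v j + y) avj≡0 (cong (if_then 1 else 0) (dec-false (v Fin.≟ j) v≢j)) ⟨
    a v j + h v j + equality v j
      ≡⟨ partition v j ⟩
    1 ∎
    where
    open ≡-Reasoning
    avj≡0 : a v j ≡ 0
    avj≡0 = All.lookup (∑≡0⇒All (allFin n) {a v} isolated) (∈-allFin j)

  nonadjacency≤codegree : ∀ v j → h v j ≤ codegree j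
  nonadjacency≤codegree v j = ≤-trans (All.lookup (≤∑ (allFin n) (λ i → h i j)) (∈-allFin v))
    (≤-reflexive (sym (codegree-column j)))

  -- By A = J - I - H the condition wA ≤ cw becomes a lower bound on the weight of the nonneighbours
  -- of j, which suits counting nonedges.
  weightsBounding : ∀ c (w : Fin n → ℕ) → (∀ i → 1 ≤ w i) →
    (∀ j → ∑ (allFin n) w ≤ suc c * w j + ∑ (allFin n) (λ i → w i * h i j)) →
    WeightsBounding c G
  weightsBounding c w 1≤w bound = w , 1≤w , (λ j →
    ≤-by 0 (≤-trans (≤-reflexive (∑-partition w j)) (bound j))
      (eq (∑ (allFin n) (λ i → w i * a i j)) (∑ (allFin n) (λ i → w i * h i j)) (w j) c))
    where
    eq : ∀ x y w c → x + (suc c * w + y) + 0 ≡ c * w + (x + y + w)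
    eq = solve-∀

-- Certificates for graphs with many nonedges

module _ {k} (G : Graph (Fin (2 + k))) where

  private
    n = 2 + k
    a = adjacency G
    h = nonadjacency G
    Σh = ∑ (allFin n) (codegree G)

  -- Constant weights work because every degree is at most k: v itself has degree 0, and any other
  -- vertex has v as a nonneighbour.
  isolatedVertex : ∀ v → degree G v ≡ 0 → WeightsBounding k G
  isolatedVertex v isolated = weightsBounding G k (λ _ → 1) (λ _ → ≤-refl) (λ j →
    ≤-by 0 (codegree≥1 j) (trans (cong (λ s → s + codegree G j + 0) (∑-allFin n 1))
      (trans (eq k (codegree G j)) (cong (λ s → suc k * 1 + s + 1)
        (trans (codegree-column G j) (∑-cong (allFin n) (λ i → sym (*-identityˡ (h i j)))))))))
    where
    eq : ∀ k c → (2 + k) * 1 + c + 0 ≡ suc k * 1 + c + 1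
    eq = solve-∀
    codegree≥1 : ∀ j → 1 ≤ codegree G j
    codegree≥1 j with v Fin.≟ j
    ... | yes refl = ≤-by k (≤-reflexive (trans (sym (degree+codegree G v)) (cong (λ s → s + codegree G v + 1) isolated)))
                       (eq′ k (codegree G v))
      where
      eq′ : ∀ k c → 1 + (0 + c + 1) + k ≡ c + (2 + k)
      eq′ = solve-∀
    ... | no v≢j = ≤-trans (≤-reflexive (sym (isolated⇒nonadjacent G j isolated v≢j)))
                     (nonadjacency≤codegree G v j)

  -- Hong's bound ρ² ≤ 2m - n + 1 for graphs without isolated vertices, in the range needed.
  fewNonedges : ¬ WeightsBounding k G → Σh ≤ 2 * k
  fewNonedges large with extract (λ i → zero? (degree G i)) (allFin n)
  ... | inj₁ (v , _ , isolated , _) = contradiction (isolatedVertex v isolated) large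
  ... | inj₂ 1≤d with Σh ≤? 2 * k
  ...   | yes le = le
  ...   | no ≰ = contradiction (weightsBounding G k (λ i → k + degree G i)
          (λ i → ≤-trans (All.lookup 1≤d (∈-allFin i)) (m≤n+m _ k)) bound) large
    where
    Σd = ∑ (allFin n) (degree G)
    -- Isolated vertices were split off for this estimate: now every weight is at least `suc k`.
    many : ∀ j → suc k * codegree G j ≤ ∑ (allFin n) (λ i → (k + degree G i) * h i j)
    many j = begin
      suc k * codegree G j
        ≡⟨ cong (suc k *_) (codegree-column G j) ⟩
      suc k * ∑ (allFin n) (λ i → h i j)
        ≡⟨ ∑-* (allFin n) (suc k) (λ i → h i j) ⟨
      ∑ (allFin n) (λ i → suc k * h i j)
        ≤⟨ ∑-mono (allFin n) (All.map (λ {i} 1≤ →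
             *-monoˡ-≤ (h i j) (≤-trans (≤-reflexive (+-comm 1 k)) (+-monoʳ-≤ k 1≤))) 1≤d) ⟩
      ∑ (allFin n) (λ i → (k + degree G i) * h i j) ∎
      where open ≤-Reasoning
    bound : ∀ j → ∑ (allFin n) (λ i → k + degree G i) ≤
      suc k * (k + degree G j) + ∑ (allFin n) (λ i → (k + degree G i) * h i j)
    bound j = begin
      ∑ (allFin n) (λ i → k + degree G i)
        ≡⟨ ∑-+ (allFin n) (λ _ → k) (degree G) ⟩
      ∑ (allFin n) (λ _ → k) + Σd
        ≡⟨ cong (_+ Σd) (∑-allFin n k) ⟩
      n * k + Σd
        -- Since degree and codegree of j add up to k + 1, the right side is (k + 1)(2k + 1) for
        -- every j. The left side is 2k² + 5k + 2 - Σh, so Σh ≥ 2k + 1 is exactly what is needed.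
        ≤⟨ ≤-by 0 (+-mono-≤ (≰⇒> ≰) (+-mono-≤ (≤-reflexive (totalDegree G))
             (*-monoʳ-≤ (suc k) (≤-reflexive (sym (degree+codegree G j))))))
             (eq k Σd Σh (degree G j) (codegree G j)) ⟩
      suc k * (k + degree G j) + suc k * codegree G j
        ≤⟨ +-monoʳ-≤ (suc k * (k + degree G j)) (many j) ⟩
      suc k * (k + degree G j) + ∑ (allFin n) (λ i → (k + degree G i) * h i j) ∎
      where
      open ≤-Reasoning
      eq : ∀ k D H d c →
        (2 + k) * k + D + (H + ((2 + k) * (2 + k) + suc k * (d + c + 1))) + 0 ≡
        suc k * (k + d) + suc k * c + (suc (2 * k) + (D + H + (2 + k) * 1 + suc k * (2 + k)))
      eq = solve-∀

module _ (G : Graph (Fin 5)) {z p r x y : Fin 5} (vs↭ : z ∷ p ∷ r ∷ x ∷ y ∷ [] ↭ allFin 5) where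

  private
    h = nonadjacency G

  -- The graph is the join of K₂ with three independent vertices. It has three nonedges, which is n
  -- - 2, so the count does not exclude it and an explicit eigenvector is used.
  complementTriangle : h x y ≡ 1 → h x r ≡ 1 → h y r ≡ 1 →
    h x z ≡ 0 → h y z ≡ 0 → h x p ≡ 0 → h y p ≡ 0 → h z p ≡ 0 → h z r ≡ 0 → h p r ≡ 0 →
    WeightsBounding 3 G
  complementTriangle xy xr yr xz yz xp yp zp zr pr = weightsBounding G 3 w
    (λ i → All.lookup (Perm.All-resp-↭ vs↭ positive) (∈-allFin i))
    (λ j → All.lookup (Perm.All-resp-↭ vs↭ bounds) (∈-allFin j))
    where
    -- Twice 3 on z and p, twice 2 on the triangle: an eigenvector for the eigenvalue 3.
    w : Fin 5 → ℕ
    w i = 6 ∸ codegree G i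
    irr = nonadjacency-irrefl G
    flip : ∀ u v {c} → h u v ≡ c → h v u ≡ c
    flip u v eq = trans (nonadjacency-sym G v u) eq
    sum₅ : ∀ (f : Fin 5 → ℕ) {a b c d e} → f z ≡ a → f p ≡ b → f r ≡ c → f x ≡ d → f y ≡ e →
      ∑ (allFin 5) f ≡ a + (b + (c + (d + (e + 0))))
    sum₅ f refl refl refl refl refl = sym (∑-↭ vs↭ f)
    wz : w z ≡ 6
    wz = cong (6 ∸_) (sum₅ (h z) (irr z) zp zr (flip x z xz) (flip y z yz))
    wp : w p ≡ 6
    wp = cong (6 ∸_) (sum₅ (h p) (flip z p zp) (irr p) pr (flip x p xp) (flip y p yp))
    wr : w r ≡ 4
    wr = cong (6 ∸_) (sum₅ (h r) (flip z r zr) (flip p r pr) (irr r) (flip x r xr) (flip y r yr))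
    wx : w x ≡ 4
    wx = cong (6 ∸_) (sum₅ (h x) xz xp xr (irr x) xy)
    wy : w y ≡ 4
    wy = cong (6 ∸_) (sum₅ (h y) yz yp yr (flip x y xy) (irr y))
    positive : All (λ i → 1 ≤ w i) (z ∷ p ∷ r ∷ x ∷ y ∷ [])
    positive = at z wz ∷ at p wp ∷ at r wr ∷ at x wx ∷ at y wy ∷ []
      where
      at : ∀ i {m} → w i ≡ suc m → 1 ≤ w i
      at i eq = ≤-trans (s≤s z≤n) (≤-reflexive (sym eq))
    W : ∑ (allFin 5) w ≡ 24
    W = sum₅ w wz wp wr wx wy
    column : ∀ j {a b c d e} → h z j ≡ a → h p j ≡ b → h r j ≡ c → h x j ≡ d → h y j ≡ e →
      ∑ (allFin 5) (λ i → w i * h i j) ≡ 6 * a + (6 * b + (4 * c + (4 * d + (4 * e + 0))))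
    column j a b c d e = sum₅ (λ i → w i * h i j)
      (cong₂ _*_ wz a) (cong₂ _*_ wp b) (cong₂ _*_ wr c) (cong₂ _*_ wx d) (cong₂ _*_ wy e)
    bounds : All (λ j → ∑ (allFin 5) w ≤ 4 * w j + ∑ (allFin 5) (λ i → w i * h i j)) (z ∷ p ∷ r ∷ x ∷ y ∷ [])
    bounds =
      full z wz ∷ full p wp
      ∷ tight r wr (column r (zr) (pr) (irr r) xr yr)
      ∷ tight x wx (column x (flip x z xz) (flip x p xp) (flip x r xr) (irr x) (flip x y xy))
      ∷ tight y wy (column y (flip y z yz) (flip y p yp) (flip y r yr) xy (irr y)) ∷ []
      where
      full : ∀ j → w j ≡ 6 → ∑ (allFin 5) w ≤ 4 * w j + ∑ (allFin 5) (λ i → w i * h i j)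
      full j eq = ≤-trans (≤-reflexive (trans W (sym (cong (4 *_) eq)))) (m≤m+n (4 * w j) _)
      tight : ∀ j → w j ≡ 4 → ∑ (allFin 5) (λ i → w i * h i j) ≡ 8 →
        ∑ (allFin 5) w ≤ 4 * w j + ∑ (allFin 5) (λ i → w i * h i j)
      tight j eq eq′ = ≤-reflexive (trans W (sym (cong₂ (λ u v → 4 * u + v) eq eq′)))

-- From lists back to permutations

-- A permutation of lists carries a bijection of positions. As `allFin n` has i at position i, this
-- bijection sends each position to the value of f there; the casts only adjust lengths.
enumerate : ∀ {m n} (f : Fin m → Fin n) → tabulate f ↭ allFin n →
  Σ (Permutation m n) λ β → ∀ i → β ⟨$⟩ʳ i ≡ f i
enumerate {m} {n} f p = (Permutation.cast-id m≡ ∘ₚ onIndices p′) ∘ₚ Permutation.cast-id (sym n≡) , values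
  where
  p′ = ↭⇒↭ₛ p
  m≡ : m ≡ length (tabulate f)
  m≡ = sym (List.length-tabulate f)
  n≡ : n ≡ length (allFin n)
  n≡ = sym (List.length-tabulate id)
  values : ∀ i → cast (sym n≡) (onIndices p′ ⟨$⟩ʳ cast m≡ i) ≡ f i
  values i = begin
    cast (sym n≡) j
      ≡⟨ List.lookup-tabulate id (cast (sym n≡) j) ⟨
    lookup (allFin n) (cast n≡ (cast (sym n≡) j))
      ≡⟨ cong (lookup (allFin n)) (Fin.cast-involutive n≡ (sym n≡) j) ⟩
    lookup (allFin n) j
      ≡⟨ PermSetoid.onIndices-lookup (setoid (Fin n)) p′ (cast m≡ i) ⟨
    lookup (tabulate f) (cast m≡ i)
      ≡⟨ List.lookup-tabulate f i ⟩
    f i ∎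
    where
    open ≡-Reasoning
    j = onIndices p′ ⟨$⟩ʳ cast m≡ i

permutation-injective : ∀ {m n} (β : Permutation m n) {i j} → β ⟨$⟩ʳ i ≡ β ⟨$⟩ʳ j → i ≡ j
permutation-injective β {i} {j} eq =
  trans (sym (Permutation.inverseˡ β)) (trans (cong (β ⟨$⟩ˡ_) eq) (Permutation.inverseˡ β))

next-inject₁ : ∀ {m} (j : Fin m) → next (inject₁ j) ≡ suc j
next-inject₁ {m} j = Fin.toℕ-injective (begin
  toℕ (next (inject₁ j))         ≡⟨ Fin.toℕ-fromℕ< (m%n<n (suc (toℕ (inject₁ j))) (suc m)) ⟩
  suc (toℕ (inject₁ j)) % suc m  ≡⟨ cong (λ t → suc t % suc m) (Fin.toℕ-inject₁ j) ⟩
  suc (toℕ j) % suc m            ≡⟨ m<n⇒m%n≡m (s≤s (Fin.toℕ<n j)) ⟩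
  suc (toℕ j)                    ∎)
  where open ≡-Reasoning

next-fromℕ : ∀ m → next (Fin.fromℕ m) ≡ zero
next-fromℕ m = Fin.toℕ-injective (begin
  toℕ (next (Fin.fromℕ m))         ≡⟨ Fin.toℕ-fromℕ< (m%n<n (suc (toℕ (Fin.fromℕ m))) (suc m)) ⟩
  suc (toℕ (Fin.fromℕ m)) % suc m  ≡⟨ cong (λ t → suc t % suc m) (Fin.toℕ-fromℕ m) ⟩
  suc m % suc m                ≡⟨ n%n≡0 (suc m) ⟩
  0                            ∎)
  where open ≡-Reasoning

next≢ : ∀ {m} (k : Fin (2 + m)) → k ≢ next k
next≢ {m} k eq with view k
... | ‵fromℕ with () ← trans eq (next-fromℕ (suc m))
... | ‵inject₁ j = contradiction (cong toℕ (trans eq (next-inject₁ j)))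
        (<⇒≢ (≤-reflexive (cong suc (Fin.toℕ-inject₁ j))))

module _ {V : Set} where
  open Cycles {V}

  tabulate-steps : ∀ x zs b (g : Fin (suc (length zs)) → V) →
    (∀ j → g (inject₁ j) ≡ lookup zs j) → g (Fin.fromℕ (length zs)) ≡ b →
    tabulate (λ k → lookup (x ∷ zs) k , g k) ≡ steps x zs b
  tabulate-steps x []       b g inner last = cong (λ v → (x , v) ∷ []) last
  tabulate-steps x (z ∷ zs) b g inner last =
    cong₂ (λ v es → (x , v) ∷ es) (inner zero) (tabulate-steps z zs b (g ∘ suc) (inner ∘ suc) last)

  tabulateCycle : ∀ {m} x zs → suc (length zs) ≡ m → Σ (Fin m → V) λ f →
    tabulate f ≡ x ∷ zs × tabulate (λ k → f k , f (next k)) ≡ cycle (x ∷ zs)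
  tabulateCycle x zs refl = lookup (x ∷ zs) , List.tabulate-lookup (x ∷ zs)
    , tabulate-steps x zs x (λ k → lookup (x ∷ zs) (next k))
        (λ j → cong (lookup (x ∷ zs)) (next-inject₁ j))
        (cong (lookup (x ∷ zs)) (next-fromℕ (length zs)))

∑-tabulate : ∀ {n} (e : Fin n → A) (f : A → ℕ) → ∑ (tabulate e) f ≡ ∑ (allFin n) (f ∘ e)
∑-tabulate {n = n} e f = trans (cong (λ xs → ∑ xs f) (sym (List.map-tabulate id e))) (∑-map (allFin n) e f)

allPositive⇒≤∑ : ∀ n {f : Fin n → ℕ} → All (λ i → 1 ≤ f i) (allFin n) → n ≤ ∑ (allFin n) f
allPositive⇒≤∑ n {f} pos = subst (_≤ ∑ (allFin n) f) (trans (∑-allFin n 1) (*-identityʳ n)) (∑-mono (allFin n) pos)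

-- Nonedge counts of a family, and labelling a cycle

module Family {n m} (G : Fin m → Graph (Fin n)) where

  h : Fin m → Fin n → Fin n → ℕ
  h i = nonadjacency (G i)

  t : Fin n → Fin n → ℕ
  t u v = ∑ (allFin m) (λ i → h i u v)

  t-sym : ∀ u v → t u v ≡ t v u
  t-sym u v = ∑-cong (allFin m) (λ i → nonadjacency-sym (G i) u v)

  t-irrefl : ∀ v → t v v ≡ 0
  t-irrefl v = ∑≡0 (allFin m) (All.universal (λ i → nonadjacency-irrefl (G i) v) (allFin m))

  t≤ : ∀ u v → t u v ≤ m
  t≤ u v = subst (t u v ≤_) (trans (∑-allFin m 1) (*-identityʳ m))
    (∑-mono (allFin m) (All.universal (λ i → nonadjacency≤1 (G i) u v) (allFin m)))

  t≡0⇒h≡0 : ∀ {u v} → t u v ≡ 0 → ∀ i → h i u v ≡ 0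
  t≡0⇒h≡0 {u} {v} eq i = All.lookup (∑≡0⇒All (allFin m) {λ i → h i u v} eq) (∈-allFin i)

  t≡m⇒h≡1 : ∀ {u v} → t u v ≡ m → ∀ i → h i u v ≡ 1
  t≡m⇒h≡1 {u} {v} eq i with zero? (h i u v)
  ... | inj₂ pos = ≤-antisym (nonadjacency≤1 (G i) u v) pos
  ... | inj₁ hi≡0 = contradiction strict (<⇒≱ (≤-reflexive refl))
    where
    -- Raising the vanishing summand keeps all summands at most 1.
    raised : ∑ (allFin m) (λ j → h j u v + 1 * equality j i) ≤ m
    raised = subst (∑ (allFin m) (λ j → h j u v + 1 * equality j i) ≤_) (trans (∑-allFin m 1) (*-identityʳ m))
      (∑-mono (allFin m) (All.universal at (allFin m)))
      where
      at : ∀ j → h j u v + 1 * equality j i ≤ 1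
      at j with j Fin.≟ i
      ... | yes refl = ≤-reflexive (cong (_+ 1) hi≡0)
      ... | no _     = subst (_≤ 1) (sym (+-identityʳ (h j u v))) (nonadjacency≤1 (G j) u v)
    strict : suc m ≤ m
    strict = subst (_≤ m) (trans (∑-+ (allFin m) (λ j → h j u v) (λ j → 1 * equality j i))
      (trans (cong₂ _+_ eq (∑-equality (λ _ → 1) i)) (+-comm m 1))) raised

  private
    module C = Cycles {Fin n}
  open Cycles.Weighted {Fin n} t t-sym t-irrefl public

  pairsₕ : Fin m → List (Fin n) → ℕ
  pairsₕ i = Cycles.Weighted.pairs (h i) (nonadjacency-sym (G i)) (nonadjacency-irrefl (G i))

  pairs-∑ : ∀ vs → pairs vs ≡ ∑ (allFin m) (λ i → pairsₕ i vs)
  pairs-∑ []       = sym (∑≡0 (allFin m) (All.universal (λ _ → refl) (allFin m)))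
  pairs-∑ (v ∷ vs) = trans (cong₂ _+_ (∑-comm vs (allFin m) (λ u i → h i v u)) (pairs-∑ vs))
    (sym (∑-+ (allFin m) (λ i → ∑ vs (h i v)) (λ i → pairsₕ i vs)))

  module _ (x : Fin n) (zs : List (Fin n)) (vs↭ : x ∷ zs ↭ allFin n) (length≡ : suc (length zs) ≡ m) (3≤m : 3 ≤ m)
    (light : weight (C.cycle (x ∷ zs)) + 3 ≤ 2 * m) (unblocked : All (Light m) (C.cycle (x ∷ zs)))
    (few : ∀ i → pairsₕ i (x ∷ zs) < m)
    where

    -- Graphs are matched with edges of the cycle, at cost 1 where the edge is missing. Column sums
    -- are the values of t, kept below m by `unblocked`; row sums count nonedges of `G i` on the
    -- cycle, kept below m by `few`.
    labelCycle : Σ (Permutation m n) λ π → Σ (Permutation m m) λ σ →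
      ∀ i → Edge (G i) (π ⟨$⟩ʳ (σ ⟨$⟩ʳ i)) (π ⟨$⟩ʳ next (σ ⟨$⟩ʳ i))
    labelCycle = π , σ , edges
      where
      place : Σ (Fin m → Fin n) λ f →
        tabulate f ≡ x ∷ zs × tabulate (λ k → f k , f (next k)) ≡ C.cycle (x ∷ zs)
      place = tabulateCycle x zs length≡
      vertices : Σ (Permutation m n) λ π → ∀ k → π ⟨$⟩ʳ k ≡ proj₁ place k
      vertices = enumerate (proj₁ place) (↭-trans (↭-reflexive (proj₁ (proj₂ place))) vs↭)
      π = proj₁ vertices
      e : Fin m → Fin n × Fin n
      e k = proj₁ place k , proj₁ place (next k)
      b : Fin m → Fin m → ℕ
      b i k = uncurry (h i) (e k)
      open Matching b
      ∑-cycle : ∀ (w : Fin n → Fin n → ℕ) → ∑ (allFin m) (λ k → uncurry w (e k)) ≡ ∑ (C.cycle (x ∷ zs)) (uncurry w)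
      ∑-cycle w = trans (sym (∑-tabulate e (uncurry w))) (cong (λ es → ∑ es (uncurry w)) (proj₂ (proj₂ place)))
      total≡ : total (allFin m) (allFin m) ≡ weight (C.cycle (x ∷ zs))
      total≡ = trans (∑-comm (allFin m) (allFin m) b) (∑-cycle t)
      row≤ : ∀ i → ∑ (allFin m) (b i) ≤ pairsₕ i (x ∷ zs)
      row≤ i = subst (_≤ pairsₕ i (x ∷ zs)) (sym (∑-cycle (h i))) (bound zs (subst (3 ≤_) (sym length≡) 3≤m))
        where
        bound : ∀ zs → 3 ≤ suc (length zs) → ∑ (C.cycle (x ∷ zs)) (uncurry (h i)) ≤ pairsₕ i (x ∷ zs)
        bound []       (s≤s ())
        bound (z ∷ zs) le with initLast zs
        bound (z ∷ .[])           (s≤s (s≤s ())) | []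
        bound (z ∷ .(ys ∷ʳ y)) _ | ys ∷ʳ′ y =
          Cycles.Weighted.cycle≤pairs (h i) (nonadjacency-sym (G i)) (nonadjacency-irrefl (G i)) x z ys y
      matching : PerfectMatching (allFin m) (allFin m)
      matching = perfectMatching (allFin m) (allFin m) refl
        (subst₂ (λ T l → T + 3 ≤ 2 * l) (sym total≡) (sym (List.length-tabulate {n = m} id)) light)
        (λ i full → contradiction (≤-trans (allPositive⇒≤∑ m full) (row≤ i)) (<⇒≱ (few i)))
        (λ k full → contradiction (allPositive⇒≤∑ m full)
          (<⇒≱ (All.tabulate⁻ {f = e} (subst (All (Light m)) (sym (proj₂ (proj₂ place))) unblocked) k)))
      ps = proj₁ matching
      listing : ∀ (f : Fin m × Fin m → Fin m) → map f ps ↭ allFin m →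
        Σ (Permutation (length ps) m) λ β → ∀ q → β ⟨$⟩ʳ q ≡ f (lookup ps q)
      listing f p = enumerate (f ∘ lookup ps) (↭-trans (↭-reflexive
        (trans (sym (List.map-tabulate (lookup ps) f)) (cong (map f) (List.tabulate-lookup ps)))) p)
      ρ = listing proj₁ (proj₁ (proj₂ matching))
      κ = listing proj₂ (proj₁ (proj₂ (proj₂ matching)))
      -- `ρ` and `κ` send a position of the matching to its row and to its column, so this composite
      -- sends a graph to the edge matched with it.
      σ : Permutation m m
      σ = Permutation.flip (proj₁ ρ) ∘ₚ proj₁ κ
      fits : ∀ q → b (proj₁ (lookup ps q)) (proj₂ (lookup ps q)) ≡ 0
      fits q = All.lookup (proj₂ (proj₂ (proj₂ matching))) (∈-lookup q)
      edges : ∀ i → Edge (G i) (π ⟨$⟩ʳ (σ ⟨$⟩ʳ i)) (π ⟨$⟩ʳ next (σ ⟨$⟩ʳ i))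
      edges i = nonadjacency≡0⇒Edge (G i)
        -- As `nonadjacency` vanishes on the diagonal too, the ends of the edge must be shown to
        -- differ.
        (λ eq → distinct 3≤m (σ ⟨$⟩ʳ i) (permutation-injective π eq))
        (trans (cong₂ (h i) (proj₂ vertices (σ ⟨$⟩ʳ i)) (proj₂ vertices (next (σ ⟨$⟩ʳ i))))
          (trans (cong₂ b (sym row) (proj₂ κ q)) (fits q)))
        where
        q = proj₁ ρ ⟨$⟩ˡ i
        row : proj₁ (lookup ps q) ≡ i
        row = trans (sym (proj₂ ρ q)) (Permutation.inverseʳ (proj₁ ρ))
        distinct : ∀ {m} → 3 ≤ m → (k : Fin m) → k ≢ next k
        distinct (s≤s (s≤s (s≤s _))) k = next≢ k

-- Recognising the exceptional family

tabulate-splitAt : ∀ m {n} (f : Fin m → A) (g : Fin n → A) →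
  tabulate ([ f , g ]′ ∘ splitAt m) ≡ tabulate f ++ tabulate g
tabulate-splitAt zero    f g = refl
tabulate-splitAt (suc m) f g = cong (f zero ∷_)
  (trans (List.tabulate-cong (λ i → join (splitAt m i))) (tabulate-splitAt m (f ∘ suc) g))
  where
  join : ∀ s → [ f , g ]′ (Sum.map suc id s) ≡ [ f ∘ suc , g ]′ s
  join (inj₁ _) = refl
  join (inj₂ _) = refl

asTabulate : ∀ (xs : List A) {k} → length xs ≡ k → Σ (Fin k → A) λ f → tabulate f ≡ xs
asTabulate xs refl = lookup xs , List.tabulate-lookup xs

Exceptional : ∀ {n} → (Fin n → Graph (Fin n)) → Set
Exceptional {n} G = (∀ i j → G i ≐ G j) × (∀ i → G i ≅ K 1 ∨ (K (n ∸ 2) ∪ K 1))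

module _ {k} (G : Fin (2 + k) → Graph (Fin (2 + k))) where

  private
    n = 2 + k
  open Family G

  -- In every graph x has z as its only neighbour and all other pairs are adjacent: z is the cone
  -- vertex of the join and x the pendant one.
  module StarComplement (z x : Fin n) (ks : Fin k → Fin n)
    (vs↭ : z ∷ tabulate ks ∷ʳ x ↭ allFin n)
    (heavy : ∀ j → t x (ks j) ≡ n) (light : t x z ≡ 0)
    (light₁ : ∀ j → t z (ks j) ≡ 0) (light₂ : ∀ j l → t (ks j) (ks l) ≡ 0)
    where

    private
      V = Fin 1 ⊎ (Fin k ⊎ Fin 1)
      H = K 1 ∨ (K k ∪ K 1)

      vertex : V → Fin n
      vertex = [ (λ _ → z) , [ ks , (λ _ → x) ]′ ]′

      ψ : Fin (1 + (k + 1)) ↔ V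
      ψ = (↔-id (Fin 1) ⊎-↔ Fin.+↔⊎ {k} {1}) ↔-∘ Fin.+↔⊎ {1} {k + 1}

      listed : tabulate (vertex ∘ Inverse.to ψ) ≡ z ∷ tabulate ks ∷ʳ x
      listed = cong (z ∷_) (tabulate-splitAt k ks (λ _ → x))

      enumeration = enumerate (vertex ∘ Inverse.to ψ) (↭-trans (↭-reflexive listed) vs↭)
      β = proj₁ enumeration

      iso : Fin n ↔ V
      iso = ψ ↔-∘ ↔-sym β

      vertex-iso : ∀ u → vertex (Inverse.to iso u) ≡ u
      vertex-iso u = trans (sym (proj₂ enumeration (β ⟨$⟩ˡ u))) (Permutation.inverseʳ β)

      vertex-injective : ∀ a b → vertex a ≡ vertex b → a ≡ b
      vertex-injective a b eq = trans (sym (Inverse.strictlyInverseˡ ψ a))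
        (trans (cong (Inverse.to ψ) (permutation-injective β {Inverse.from ψ a} {Inverse.from ψ b}
            (trans (at a) (trans eq (sym (at b))))))
          (Inverse.strictlyInverseˡ ψ b))
        where
        at : ∀ a → β ⟨$⟩ʳ Inverse.from ψ a ≡ vertex a
        at a = trans (proj₂ enumeration (Inverse.from ψ a)) (cong vertex (Inverse.strictlyInverseˡ ψ a))

      present : ∀ i a b → a ≢ b → t (vertex a) (vertex b) ≡ 0 → adj (G i) (vertex a) (vertex b) ≡ true
      present i a b a≢b eq = nonadjacency≡0⇒Edge (G i) {vertex a} {vertex b}
        (a≢b ∘ vertex-injective a b) (t≡0⇒h≡0 {vertex a} {vertex b} eq i)

      absent : ∀ i u v → t u v ≡ n → adj (G i) u v ≡ false
      absent i u v eq = nonadjacency≡1⇒¬adj (G i) {u} {v} (t≡m⇒h≡1 {u} {v} eq i)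

      adj≡ : ∀ i a b → adj (G i) (vertex a) (vertex b) ≡ adj H a b
      adj≡ i (inj₁ zero) (inj₁ zero) = Graph.irrefl (G i) z
      adj≡ i (inj₁ zero) (inj₂ (inj₁ j)) = present i (inj₁ zero) (inj₂ (inj₁ j)) (λ ()) (light₁ j)
      adj≡ i (inj₁ zero) (inj₂ (inj₂ zero)) = present i (inj₁ zero) (inj₂ (inj₂ zero)) (λ ()) (trans (t-sym z x) light)
      adj≡ i (inj₂ (inj₁ j)) (inj₁ zero) =
        present i (inj₂ (inj₁ j)) (inj₁ zero) (λ ()) (trans (t-sym (ks j) z) (light₁ j))
      adj≡ i (inj₂ (inj₁ j)) (inj₂ (inj₁ l)) with j Fin.≟ l
      ... | yes refl = Graph.irrefl (G i) (ks j)
      ... | no j≢l = present i (inj₂ (inj₁ j)) (inj₂ (inj₁ l)) (λ { refl → j≢l refl }) (light₂ j l)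
      adj≡ i (inj₂ (inj₁ j)) (inj₂ (inj₂ zero)) = absent i (ks j) x (trans (t-sym (ks j) x) (heavy j))
      adj≡ i (inj₂ (inj₂ zero)) (inj₁ zero) = present i (inj₂ (inj₂ zero)) (inj₁ zero) (λ ()) light
      adj≡ i (inj₂ (inj₂ zero)) (inj₂ (inj₁ j)) = absent i x (ks j) (heavy j)
      adj≡ i (inj₂ (inj₂ zero)) (inj₂ (inj₂ zero)) = Graph.irrefl (G i) x

      adj-iso : ∀ i u v → adj (G i) u v ≡ adj H (Inverse.to iso u) (Inverse.to iso v)
      adj-iso i u v = trans (sym (cong₂ (adj (G i)) (vertex-iso u) (vertex-iso v)))
        (adj≡ i (Inverse.to iso u) (Inverse.to iso v))

    -- One bijection `iso` serves all the graphs, which therefore coincide besides being isomorphic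
    -- to the join.
    exceptional : Exceptional G
    exceptional = (λ i j u v → trans (adj-iso i u v) (sym (adj-iso j u v))) , (λ i → iso , adj-iso i)

  star⇒exceptional : ∀ {vs} → vs ↭ allFin n → Star n vs → Exceptional G
  star⇒exceptional {vs} vs↭ record { z = z ; x = x ; ks = ks ; vs↭ = star↭ ; wx = wx ; wxz = wxz ; inner = inner } =
    go ks lengthks (proj₂ (asTabulate ks lengthks)) star↭ wx inner
    where
    lengthks : length ks ≡ k
    lengthks = +-cancelʳ-≡ 2 _ _ (begin
      length ks + 2                    ≡⟨ +-suc (length ks) 1 ⟩
      suc (length ks + 1)              ≡⟨ cong suc (List.length-++ ks {x ∷ []}) ⟨
      length (z ∷ ks ∷ʳ x)             ≡⟨ Perm.↭-length (↭-trans star↭ vs↭) ⟩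
      length (allFin n)                ≡⟨ List.length-tabulate {n = n} id ⟩
      2 + k                            ≡⟨ +-comm 2 k ⟩
      k + 2                            ∎)
      where open ≡-Reasoning
    go : ∀ ks (l : length ks ≡ k) → tabulate (proj₁ (asTabulate ks l)) ≡ ks → z ∷ ks ∷ʳ x ↭ vs →
      All (λ v → t x v ≡ n) ks → pairs (z ∷ ks) ≡ 0 → Exceptional G
    go ks l eq star↭ wx inner = StarComplement.exceptional z x f
      (subst (λ ks → z ∷ ks ∷ʳ x ↭ allFin n) (sym eq) (↭-trans star↭ vs↭))
      (All.tabulate⁻ {f = f} (subst (All _) (sym eq) wx)) wxz
      (λ j → All.tabulate⁻ {f = f} (subst (All _) (sym eq) (All.tail (All.head zeros))) j)
      (λ j l → All.tabulate⁻ {f = f} (subst (All _) (sym eq) (All.tail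
        (All.tabulate⁻ {f = f} (subst (All _) (sym eq) (All.tail zeros)) j))) l)
      where
      f = proj₁ (asTabulate ks l)
      -- Passing to ordered pairs makes every entry of t on z ∷ ks vanish, whatever the order in
      -- which the list presents the two vertices.
      zeros : All (λ u → All (λ v → t u v ≡ 0) (z ∷ ks)) (z ∷ ks)
      zeros = All.map (λ {u} → ∑≡0⇒All (z ∷ ks) {t u})
        (∑≡0⇒All (z ∷ ks) {λ u → ∑ (z ∷ ks) (t u)} (trans (double-pairs (z ∷ ks)) (cong (2 *_) inner)))

-- From nonedge counts to the dichotomy

noTriangle : ∀ k (G : Fin (2 + k) → Graph (Fin (2 + k))) → (∀ i → ¬ WeightsBounding k (G i)) →
  ∀ {vs} → vs ↭ allFin (2 + k) → ¬ Family.Triangle G (2 + k) vs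
-- Matching `N≡5` with `refl` turns k into 3, the eigenvalue of the certificate for the complement
-- of a triangle.
noTriangle k G large vs↭ record
  { z = z ; p = p ; r = r ; x = x ; y = y ; vs↭ = vs↭′ ; N≡5 = refl ; wxy = wxy ; wxr = wxr ; wyr = wyr
  ; wxz = wxz ; wyz = wyz ; wxp = wxp ; wyp = wyp ; wzp = wzp ; wzr = wzr ; wpr = wpr } =
  large zero (complementTriangle (G zero) (↭-trans vs↭′ vs↭)
    (one x y wxy) (one x r wxr) (one y r wyr)
    (none x z wxz) (none y z wyz) (none x p wxp) (none y p wyp) (none z p wzp) (none z r wzr) (none p r wpr))
  where
  open Family G
  one : ∀ u v → t u v ≡ 5 → h zero u v ≡ 1
  one u v eq = t≡m⇒h≡1 {u} {v} eq zero
  none : ∀ u v → t u v ≡ 0 → h zero u v ≡ 0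
  none u v eq = t≡0⇒h≡0 {u} {v} eq zero

module _ {k} (2≤k : 2 ≤ k) (G : Fin (2 + k) → Graph (Fin (2 + k)))
  (large : ∀ i → ¬ WeightsBounding k (G i)) where

  private
    n = 2 + k
    open Family G
    module C = Cycles {Fin n}

    fewPairsₕ : ∀ {vs} → vs ↭ allFin n → ∀ i → pairsₕ i vs ≤ k
    fewPairsₕ {vs} vs↭ i = *-cancelˡ-≤ 2 (subst (_≤ 2 * k)
      (trans (double-pairsₕ (allFin n)) (cong (2 *_) (sym (pairs-↭ₕ vs↭)))) (fewNonedges (G i) (large i)))
      where
      open Cycles.Weighted (h i) (nonadjacency-sym (G i)) (nonadjacency-irrefl (G i))
        renaming (double-pairs to double-pairsₕ; pairs-↭ to pairs-↭ₕ)

    fewPairs : ∀ {vs} → vs ↭ allFin n → pairs vs ≤ n * k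
    fewPairs {vs} vs↭ = ≤-trans (≤-reflexive (pairs-∑ vs)) (≤-trans
      (∑-mono (allFin n) {λ i → pairsₕ i vs} {λ _ → k} (All.universal (fewPairsₕ vs↭) (allFin n)))
      (≤-reflexive (∑-allFin n k)))

    length≡ : ∀ {vs} → vs ↭ allFin n → length vs ≡ n
    length≡ vs↭ = trans (Perm.↭-length vs↭) (List.length-tabulate {n = n} id)

    fromGoodCycle : ∀ {vs} → vs ↭ allFin n → GoodCycle n vs → HasRainbowHamiltonianCycle G
    fromGoodCycle vs↭ (y , ys , ys↭ , bound , light) =
      labelCycle y ys ys↭′ (length≡ ys↭′) (s≤s (s≤s (≤-trans (s≤s z≤n) 2≤k))) bound light
        (λ i → s≤s (m≤n⇒m≤1+n (fewPairsₕ ys↭′ i)))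
      where ys↭′ = ↭-trans ys↭ vs↭

    fromHeavyClosing : ∀ y m x → y ∷ m ∷ʳ x ↭ allFin n → n ≤ t x y → weight (C.cycle (y ∷ m ∷ʳ x)) + 3 ≤ 2 * n →
      HasRainbowHamiltonianCycle G ⊎ Exceptional G
    fromHeavyClosing y m x vs↭ heavy light = cases (twoOpt n y m x n≡ txy light′ few)
      where
      vs↭′ : y ∷ x ∷ m ↭ allFin n
      vs↭′ = ↭-trans (prep y (Perm.∷↭∷ʳ x m)) vs↭
      n≡ : n ≡ 2 + length m
      n≡ = sym (length≡ vs↭′)
      txy : t x y ≡ n
      txy = ≤-antisym (t≤ x y) heavy
      few : pairs (y ∷ x ∷ m) ≤ n * length m
      few = subst (λ l → pairs (y ∷ x ∷ m) ≤ n * l) (+-cancelˡ-≡ 2 k (length m) n≡) (fewPairs vs↭′)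
      closing : weight (C.cycle (y ∷ m ∷ʳ x)) ≡ path y m x + (n + 0)
      closing = trans (cong weight (C.steps-++ y m x [] y))
        (trans (∑-++ (C.steps y m x) ((x , y) ∷ []) (uncurry t)) (cong (λ q → path y m x + (q + 0)) txy))
      -- The closing edge takes n of the at most 2n - 3, so the rest of the cycle weighs at most n -
      -- 3 and has no further heavy edge.
      light′ : path y m x + 3 ≤ n
      light′ = ≤-by 0 (subst (λ q → q + 3 ≤ 2 * n) closing light) (eq (path y m x) n)
        where
        eq : ∀ p n → p + 3 + 2 * n + 0 ≡ n + (p + (n + 0) + 3)
        eq = solve-∀
      cases′ : GoodCycle n (y ∷ x ∷ m) ⊎ Star n (y ∷ x ∷ m) ⊎ Triangle n (y ∷ x ∷ m) →
        HasRainbowHamiltonianCycle G ⊎ Exceptional G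
      cases′ (inj₁ good)            = inj₁ (fromGoodCycle vs↭′ good)
      cases′ (inj₂ (inj₁ star))     = inj₂ (star⇒exceptional G vs↭′ star)
      cases′ (inj₂ (inj₂ triangle)) = contradiction triangle (noTriangle k G large vs↭′)
      cases : GoodCycle n (y ∷ x ∷ m) ⊎ Rigid n (y ∷ x ∷ m) → HasRainbowHamiltonianCycle G ⊎ Exceptional G
      cases (inj₁ good)  = inj₁ (fromGoodCycle vs↭′ good)
      cases (inj₂ rigid) = cases′ (rigidCases n (sym (length≡ vs↭′)) rigid)

    -- If T were at least 2n - 2, then 2(n - 1)² ≤ 2n(n - 2), which amounts to 2 ≤ 0.
    lightCycleBound : ∀ T p → suc k * T ≤ 2 * p → p ≤ n * k → T + 3 ≤ 2 * n
    lightCycleBound T p le few with T + 3 ≤? 2 * n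
    ... | yes done = done
    ... | no ≰ = contradiction 2≤0 (λ ())
      where
      eq : ∀ k T p → 2 + (2 * p + 2 * ((2 + k) * k) + suc k * (T + 3)) + 0 ≡
        0 + (suc k * T + 2 * p + suc k * suc (2 * (2 + k)))
      eq = solve-∀
      2≤0 : 2 ≤ 0
      2≤0 = ≤-by {2} {0} {suc k * T + 2 * p + suc k * suc (2 * n)} {2 * p + 2 * (n * k) + suc k * (T + 3)} 0
        (+-mono-≤ (+-mono-≤ le (*-monoʳ-≤ 2 few)) (*-monoʳ-≤ (suc k) (≰⇒> ≰))) (eq k T p)

  rainbowOrExceptional : HasRainbowHamiltonianCycle G ⊎ Exceptional G
  rainbowOrExceptional = start (lightCycle zero (tabulate suc))
    where
    start : (∃₂ λ y ys → y ∷ ys ↭ allFin n ×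
        length (tabulate {n = suc k} suc) * path y ys y ≤ 2 * pairs (allFin n)) →
      HasRainbowHamiltonianCycle G ⊎ Exceptional G
    start (y , [] , ys↭ , _) with () ← Perm.↭-length ys↭
    start (y , z ∷ ys , ys↭ , le) = cases (All.decide (λ e → <-≤-connex (uncurry t e) n) (C.cycle (y ∷ z ∷ ys)))
      where
      light : path y (z ∷ ys) y + 3 ≤ 2 * n
      light = lightCycleBound (path y (z ∷ ys) y) (pairs (allFin n))
        (subst (λ l → l * path y (z ∷ ys) y ≤ 2 * pairs (allFin n)) (List.length-tabulate {n = suc k} suc) le)
        (fewPairs ↭-refl)
      cases : All (Light n) (C.cycle (y ∷ z ∷ ys)) ⊎ Any (λ e → n ≤ uncurry t e) (C.cycle (y ∷ z ∷ ys)) →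
        HasRainbowHamiltonianCycle G ⊎ Exceptional G
      cases (inj₁ allLight) = inj₁ (fromGoodCycle ys↭ (y , z ∷ ys , ↭-refl , light , allLight))
      cases (inj₂ heavy) =
        let y′ , m , x , vs↭ , closing , weight≡ = heavyClosing n y z ys heavy
        in fromHeavyClosing y′ m x (↭-trans vs↭ ys↭) closing (subst (λ q → q + 3 ≤ 2 * n) (sym weight≡) light)

mainTheorem2 : (n : ℕ) → 4 ≤ n →
    (G : Fin n → Graph (Fin n)) →
    (ρ : Fin n → ℝ) → (∀ i → IsSpectralRadius (G i) (ρ i)) →
    (∀ i → fromℕ (n ∸ 2) <ᴿ ρ i) →
    ¬ ((∀ i j → G i ≐ G j) × (∀ i → G i ≅ K 1 ∨ (K (n ∸ 2) ∪ K 1))) →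
    HasRainbowHamiltonianCycle G
mainTheorem2 (suc (suc k)) (s≤s (s≤s 2≤k)) G ρ isρ k<ρ notExceptional =
  [ id , (λ exceptional → contradiction exceptional notExceptional) ]′
    (rainbowOrExceptional 2≤k G (λ i w → noEigenvalueAbove (G i) k w {ρ i} (proj₁ (isρ i)) (k<ρ i)))
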